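{- For a matroid $M$ with no coloops, its catenary data, and so $\mathcal{G}(M)$, can be derived from its configuration; that is, if $M$ and $M'$ are matroids with no coloops that have the same configuration, then they have the same catenary data, and $\mathcal{G}(M)=\mathcal{G}(M')$.
   Context: A set $X$ in a matroid $M$ is cyclic if it is a union of circuits, equivalently, $M|X$ has no coloops. The set $\mathcal{Z}(M)$ of cyclic flats of $M$ (flats that are cyclic), ordered by inclusion, is a lattice. The configuration of a matroid $M$ with no coloops is the triple $(L,s,\rho)$ where $L$ is a lattice isomorphic to $\mathcal{Z}(M)$ and $s,\rho$ are functions on $L$ such that if $x\in L$ corresponds to $X\in\mathcal{Z}(M)$ then $s(x)=|X|$ and $\rho(x)=r(X)$; isomorphic lattices are not distinguished. Thus $M$ and $M'$ have the same configuration if and only if there is a lattice isomorphism $\phi:\mathcal{Z}(M)\to\mathcal{Z}(M')$ with $|\phi(X)|=|X|$ and $r_{M'}(\phi(X))=r_M(X)$ for all $X\in\mathcal{Z}(M)$. For a rank-$r$ matroid $M$ on an $n$-element set $E$, an $(n,r)$-composition is an integer sequence $(a_0,\ldots,a_r)$ with $a_0\ge0$, $a_j>0$ for $1\le j\le r$, and sum $n$. A flag is a chain $X_0\subset X_1\subset\cdots\subset X_r=E$ of flats with $r(X_j)=j$; its composition is $(|X_0|,|X_1-X_0|,\ldots,|X_r-X_{r-1}|)$. $\nu(M;a_0,\ldots,a_r)$ is the number of flags with composition $(a_0,\ldots,a_r)$; the catenary data of $M$ is the vector of these numbers indexed by $(n,r)$-compositions. $\mathcal{G}(n,r)$ is the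 vector space over a field of characteristic zero with basis the formal symbols $[\underline{r}]$, one for each $0,1$-sequence of length $n$ with exactly $r$ ones. For a permutation (linear ordering) $\pi$ of $E$, the rank sequence $\underline{r}(\pi)=r_1\ldots r_n$ has $r_j=r(\{\pi(1),\ldots,\pi(j)\})-r(\{\pi(1),\ldots,\pi(j-1)\})$, and $\mathcal{G}(M)=\sum_\pi[\underline{r}(\pi)]\in\mathcal{G}(n,r)$ over all $n!$ permutations of $E$. -}

module Defs where

open import Level using (Level; 0ℓ)
open import Algebra.Apartness.Bundles using (HeytingField; HeytingCommutativeRing)
open import Algebra.Bundles using (CommutativeRing)
import Algebra.Construct.Pointwise as Pointwise
import Algebra.Definitions.RawMonoid as RawMonoidDefs
open import Algebra.Module.Bundles using (Module)
open import Algebra.Module.Structures.Biased using (IsModuleFromLeft)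
open import Data.Bool.Base using (if_then_else_)
import Data.Bool.Properties as Bool
open import Data.Empty using (⊥-elim)
open import Data.Fin.Base using (Fin; zero; suc; toℕ; fromℕ; inject₁; punchOut)
import Data.Fin.Properties as Fin
open import Data.Fin.Subset
open import Data.Fin.Subset.Properties
open import Data.List.Base as List using (List; []; _∷_; filter; length; mapMaybe; cartesianProductWith)
open import Data.List.Relation.Unary.All as ListAll using ()
open import Data.Maybe.Base using (Maybe; just; nothing)
open import Data.Nat.Base as ℕ using (ℕ; zero; suc; _+_; _∸_; _≤_; _<_; z≤n; s≤s)
import Data.Nat.Properties as ℕ
open import Data.Product.Base using (Σ; ∃; _×_; _,_; proj₁; proj₂)
open import Data.Sum.Base using (inj₁; inj₂)
open import Data.Vec.Base as Vec using (Vec; []; _∷_; lookup; tabulate; count)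
import Data.Vec.Properties as Vec
open import Data.Vec.Relation.Unary.All using (All; []; _∷_)
import Data.Vec.Relation.Unary.AllPairs as AllPairs
open import Data.Vec.Relation.Unary.Unique.Propositional using (Unique)
open import Data.Vec.Relation.Unary.Unique.Propositional.Properties using (lookup-injective)
open import Relation.Binary.Bundles using (Poset)
import Relation.Binary.Construct.On as On
open import Relation.Binary.Morphism.Structures using (IsOrderIsomorphism)
open import Relation.Binary.PropositionalEquality
open import Relation.Nullary.Decidable using (Dec; yes; no; does; ¬?; _×-dec_; _→-dec_)
open import Relation.Nullary.Negation using (¬_)

private
  variable
    n r : ℕ
    c ℓ₁ ℓ₂ : Level

record Matroid (n : ℕ) : Set where
  field
    rank       : Subset n → ℕ
    bounded    : ∀ X → rank X ≤ ∣ X ∣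
    monotone   : ∀ {X Y} → X ⊆ Y → rank X ≤ rank Y
    submodular : ∀ X Y → rank (X ∪ Y) + rank (X ∩ Y) ≤ rank X + rank Y

  rk : ℕ
  rk = rank ⊤

open Matroid public using (rank; rk)

module _ (M : Matroid n) where

  IsIndependent : Subset n → Set
  IsIndependent X = rank M X ≡ ∣ X ∣

  IsBasis : Subset n → Set
  IsBasis B = IsIndependent B × (∀ I → IsIndependent I → ¬ (B ⊂ I))

  IsColoop : Fin n → Set
  IsColoop e = ∀ B → IsBasis B → e ∈ B

  NoColoops : Set
  NoColoops = ∀ e → ¬ IsColoop e

  IsCircuit : Subset n → Set
  IsCircuit C = ¬ IsIndependent C × (∀ D → D ⊂ C → IsIndependent D)

  IsCyclic : Subset n → Set
  IsCyclic X = ∃ λ (Cs : List (Subset n)) → ListAll.All IsCircuit Cs × X ≡ ⋃ Cs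

  IsFlat : Subset n → Set
  IsFlat F = ∀ e → e ∉ F → rank M F < rank M (F ∪ ⁅ e ⁆)

  isFlat? : ∀ F → Dec (IsFlat F)
  isFlat? F = Fin.all? λ e → ¬? (e ∈? F) →-dec (rank M F ℕ.<? rank M (F ∪ ⁅ e ⁆))

  CyclicFlat : Set
  CyclicFlat = Σ (Subset n) λ X → IsFlat X × IsCyclic X

  -- Two cyclic flats are identified when their underlying sets are equal,
  -- whatever the proofs of flatness and cyclicity.
  𝒵 : Poset 0ℓ 0ℓ 0ℓ
  𝒵 = On.poset (⊆-poset n) (proj₁ {B = λ X → IsFlat X × IsCyclic X})

-- The lattice L enters through its order, which determines meets and joins:
-- a lattice isomorphism is the same thing as an isomorphism of the orders.
record Configuration : Set₁ where
  field
    L : Poset 0ℓ 0ℓ 0ℓ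
    s : Poset.Carrier L → ℕ
    ρ : Poset.Carrier L → ℕ

configuration : Matroid n → Configuration
configuration M = record
  { L = 𝒵 M
  ; s = λ X → ∣ proj₁ X ∣
  ; ρ = λ X → rank M (proj₁ X)
  }

infix 4 _≅_

record _≅_ (C D : Configuration) : Set where
  private
    module C = Configuration C
    module D = Configuration D
    module CL = Poset C.L
    module DL = Poset D.L
  field
    φ                  : CL.Carrier → DL.Carrier
    isOrderIsomorphism : IsOrderIsomorphism CL._≈_ DL._≈_ CL._≤_ DL._≤_ φ
    s-preserved        : ∀ x → D.s (φ x) ≡ C.s x
    ρ-preserved        : ∀ x → D.ρ (φ x) ≡ C.ρ x

vectors : ∀ {a} {A : Set a} → List A → (k : ℕ) → List (Vec A k)
vectors xs zero    = [] ∷ []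
vectors xs (suc k) = cartesianProductWith _∷_ xs (vectors xs k)

subsets : (n : ℕ) → List (Subset n)
subsets = vectors (outside ∷ inside ∷ [])

-- The side conditions of the index types below are irrelevant, so that their
-- elements are equal as soon as the underlying sequences are.
record Composition (n r : ℕ) : Set where
  constructor mkComposition
  field
    parts     : Vec ℕ (suc r)
    .positive : All (0 <_) (Vec.tail parts)
    .total    : Vec.sum parts ≡ n

open Composition public using (parts)

module _ (M : Matroid n) where

  IsFlag : Vec (Subset n) (suc (rk M)) → Set
  IsFlag X = (∀ j → IsFlat M (lookup X j) × rank M (lookup X j) ≡ toℕ j)
           × (∀ (j : Fin (rk M)) → lookup X (inject₁ j) ⊂ lookup X (suc j))
           × lookup X (fromℕ (rk M)) ≡ ⊤

  isFlag? : ∀ X → Dec (IsFlag X)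
  isFlag? X = Fin.all? (λ j → isFlat? M (lookup X j) ×-dec (rank M (lookup X j) ℕ.≟ toℕ j))
        ×-dec Fin.all? (λ j → lookup X (inject₁ j) ⊂? lookup X (suc j))
        ×-dec Vec.≡-dec Bool._≟_ (lookup X (fromℕ (rk M))) ⊤

blockSizes : Vec (Subset n) (suc r) → Vec ℕ (suc r)
blockSizes X = tabulate λ where
  zero    → ∣ lookup X zero ∣
  (suc j) → ∣ lookup X (suc j) ─ lookup X (inject₁ j) ∣

flagWithComposition? : (M : Matroid n) (a : Composition n (rk M)) →
                       ∀ X → Dec (IsFlag M X × blockSizes X ≡ parts a)
flagWithComposition? M a X = isFlag? M X ×-dec Vec.≡-dec ℕ._≟_ (blockSizes X) (parts a)

ν : (M : Matroid n) → Composition n (rk M) → ℕ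
ν {n} M a = length (filter (flagWithComposition? M a) (vectors (subsets n) (suc (rk M))))

CatenaryData : ℕ → ℕ → Set
CatenaryData n r = Composition n r → ℕ

catenaryData : (M : Matroid n) → CatenaryData n (rk M)
catenaryData M = ν M

record RankSequence (n r : ℕ) : Set where
  constructor mkRankSequence
  field
    bits      : Vec ℕ n
    .zero-one : All (_≤ 1) bits
    .ones     : count (ℕ._≟ 1) bits ≡ r

open RankSequence public using (bits)

module _ (K : HeytingField c ℓ₁ ℓ₂) where

  open HeytingField K
    using (Carrier; _≈_; 0#; 1#; heytingCommutativeRing)

  fieldRing : CommutativeRing c ℓ₁
  fieldRing = HeytingCommutativeRing.commutativeRing heytingCommutativeRing

  private
    module R = CommutativeRing fieldRing

  CharacteristicZero : Set ℓ₁
  CharacteristicZero = ∀ m → m · 1# ≈ 0# → m ≡ 0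
    where open RawMonoidDefs R.+-rawMonoid using () renaming (_×_ to infixr 8 _·_)

  -- There are finitely many symbols, so the space with the symbols as basis is
  -- the space of all K-valued functions on them.
  𝒢-space : (n r : ℕ) → Module fieldRing c ℓ₁
  𝒢-space n r = record
    { Carrierᴹ = RankSequence n r → Carrier
    ; _≈ᴹ_     = λ f g → ∀ t → f t ≈ g t
    ; _+ᴹ_     = λ f g t → f t R.+ g t
    ; _*ₗ_     = λ k f t → k R.* f t
    ; _*ᵣ_     = λ f k t → k R.* f t
    ; 0ᴹ       = λ _ → 0#
    ; -ᴹ_      = λ f t → R.- f t
    ; isModule = IsModuleFromLeft.isModule {commutativeRing = fieldRing} record
      { isLeftModule = record
        { isLeftSemimodule = record
          { +ᴹ-isCommutativeMonoid =
              Pointwise.isCommutativeMonoid (RankSequence n r) R.+-isCommutativeMonoid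
          ; isPreleftSemimodule = record
            { *ₗ-cong      = λ k≈l f≈g t → R.*-cong k≈l (f≈g t)
            ; *ₗ-zeroˡ     = λ f t → R.zeroˡ (f t)
            ; *ₗ-distribʳ  = λ f k l t → R.distribʳ (f t) k l
            ; *ₗ-identityˡ = λ f t → R.*-identityˡ (f t)
            ; *ₗ-assoc     = λ k l f t → R.*-assoc k l (f t)
            ; *ₗ-zeroʳ     = λ k t → R.zeroʳ k
            ; *ₗ-distribˡ  = λ k f g t → R.distribˡ k (f t) (g t)
            }
          }
        ; -ᴹ‿cong    = λ f≈g t → R.-‿cong (f≈g t)
        ; -ᴹ‿inverse = (λ f t → R.-‿inverseˡ (f t)) , (λ f t → R.-‿inverseʳ (f t))
        }
      }
    }

  symbol : RankSequence n r → Module.Carrierᴹ (𝒢-space n r)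
  symbol s t = if does (Vec.≡-dec ℕ._≟_ (bits s) (bits t)) then 1# else 0#

record LinearOrdering (n : ℕ) : Set where
  constructor mkLinearOrdering
  field
    elements  : Vec (Fin n) n
    .distinct : Unique elements

asOrdering : Vec (Fin n) n → Maybe (LinearOrdering n)
asOrdering v with AllPairs.allPairs? (λ x y → ¬? (x Fin.≟ y)) v
... | yes distinct = just (mkLinearOrdering v distinct)
... | no  _        = nothing

linearOrderings : (n : ℕ) → List (LinearOrdering n)
linearOrderings n = mapMaybe asOrdering (vectors (List.allFin n) n)

module _ (M : Matroid n) where

  -- X is the set of the elements of the ordering that have already been read.
  increments : ∀ {k} → Subset n → Vec (Fin n) k → Vec ℕ k
  increments X []       = []
  increments X (e ∷ es) = (rank M (X ∪ ⁅ e ⁆) ∸ rank M X) ∷ increments (X ∪ ⁅ e ⁆) es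

  open Matroid M using (bounded; monotone; submodular)

  rank-step : ∀ X e → rank M (X ∪ ⁅ e ⁆) ≤ suc (rank M X)
  rank-step X e = begin
    rank M (X ∪ ⁅ e ⁆)                        ≤⟨ ℕ.m≤m+n _ _ ⟩
    rank M (X ∪ ⁅ e ⁆) + rank M (X ∩ ⁅ e ⁆)   ≤⟨ submodular X ⁅ e ⁆ ⟩
    rank M X + rank M ⁅ e ⁆                   ≤⟨ ℕ.+-monoʳ-≤ (rank M X) (bounded ⁅ e ⁆) ⟩
    rank M X + ∣ ⁅ e ⁆ ∣                      ≡⟨ cong (rank M X +_) (∣⁅x⁆∣≡1 e) ⟩
    rank M X + 1                              ≡⟨ ℕ.+-comm (rank M X) 1 ⟩
    suc (rank M X)                            ∎
    where open ℕ.≤-Reasoning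

  increment≤1 : ∀ X e → rank M (X ∪ ⁅ e ⁆) ∸ rank M X ≤ 1
  increment≤1 X e = ℕ.m≤n+o⇒m∸n≤o _ (rank M X)
    (subst (rank M (X ∪ ⁅ e ⁆) ≤_) (ℕ.+-comm 1 (rank M X)) (rank-step X e))

  increments-zero-one : ∀ {k} X (es : Vec (Fin n) k) → All (_≤ 1) (increments X es)
  increments-zero-one X []       = []
  increments-zero-one X (e ∷ es) = increment≤1 X e ∷ increments-zero-one _ es

  union : ∀ {k} → Subset n → Vec (Fin n) k → Subset n
  union X []       = X
  union X (e ∷ es) = union (X ∪ ⁅ e ⁆) es

  ⊆-union : ∀ {k} X (es : Vec (Fin n) k) → X ⊆ union X es
  ⊆-union X []       x∈X = x∈X
  ⊆-union X (e ∷ es) x∈X = ⊆-union (X ∪ ⁅ e ⁆) es (p⊆p∪q ⁅ e ⁆ x∈X)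

  lookup∈union : ∀ {k} X (es : Vec (Fin n) k) i → lookup es i ∈ union X es
  lookup∈union X (e ∷ es) zero    = ⊆-union (X ∪ ⁅ e ⁆) es (q⊆p∪q X ⁅ e ⁆ (x∈⁅x⁆ e))
  lookup∈union X (e ∷ es) (suc i) = lookup∈union (X ∪ ⁅ e ⁆) es i

  count-step : ∀ {k} x (xs : Vec ℕ k) → x ≤ 1 →
               count (ℕ._≟ 1) (x ∷ xs) ≡ x + count (ℕ._≟ 1) xs
  count-step zero       xs _ = refl
  count-step (suc zero) xs _ = refl
  count-step (suc (suc _)) xs (s≤s ())

  count-increments : ∀ {k} X (es : Vec (Fin n) k) →
                     count (ℕ._≟ 1) (increments X es) + rank M X ≡ rank M (union X es)
  count-increments X []       = refl
  count-increments X (e ∷ es) = begin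
    count (ℕ._≟ 1) (increments X (e ∷ es)) + rank M X
      ≡⟨ cong (_+ rank M X) (count-step d (increments (X ∪ ⁅ e ⁆) es) (increment≤1 X e)) ⟩
    d + k + rank M X
      ≡⟨ cong (_+ rank M X) (ℕ.+-comm d k) ⟩
    k + d + rank M X
      ≡⟨ ℕ.+-assoc k d (rank M X) ⟩
    k + (d + rank M X)
      ≡⟨ cong (k +_) (ℕ.m∸n+n≡m (monotone (p⊆p∪q ⁅ e ⁆))) ⟩
    k + rank M (X ∪ ⁅ e ⁆)
      ≡⟨ count-increments (X ∪ ⁅ e ⁆) es ⟩
    rank M (union (X ∪ ⁅ e ⁆) es) ∎
    where
    open ≡-Reasoning
    d = rank M (X ∪ ⁅ e ⁆) ∸ rank M X
    k = count (ℕ._≟ 1) (increments (X ∪ ⁅ e ⁆) es)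

  injective⇒surjective : ∀ {m} (f : Fin m → Fin m) → (∀ i j → f i ≡ f j → i ≡ j) →
                         ∀ y → ∃ λ i → f i ≡ y
  injective⇒surjective {suc m} f inj y with Fin.any? (λ i → f i Fin.≟ y)
  ... | yes found = found
  ... | no  ¬found = ⊥-elim (ℕ.1+n≰n (Fin.injective⇒≤ {f = g} g-injective))
    where
    y≢ : ∀ i → y ≢ f i
    y≢ i y≡fi = ¬found (i , sym y≡fi)
    g : Fin (suc m) → Fin m
    g i = punchOut (y≢ i)
    g-injective : ∀ {i j} → g i ≡ g j → i ≡ j
    g-injective {i} {j} eq = inj i j (Fin.punchOut-injective (y≢ i) (y≢ j) eq)

  union-ordering : (es : Vec (Fin n) n) → Unique es → rank M (union ⊥ es) ≡ rk M
  union-ordering es distinct = ℕ.≤-antisym (monotone ⊆-⊤) (monotone ⊤⊆)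
    where
    ⊆-⊤ : union ⊥ es ⊆ ⊤
    ⊆-⊤ _ = ∈⊤
    ⊤⊆ : ⊤ ⊆ union ⊥ es
    ⊤⊆ {x} _ with i , refl ← injective⇒surjective (lookup es) (lookup-injective distinct) x
      = lookup∈union ⊥ es i

  rank-⊥ : rank M ⊥ ≡ 0
  rank-⊥ = ℕ.n≤0⇒n≡0 (subst (rank M ⊥ ≤_) (∣⊥∣≡0 n) (bounded ⊥))

  increments-ones : (es : Vec (Fin n) n) → Unique es →
                    count (ℕ._≟ 1) (increments ⊥ es) ≡ rk M
  increments-ones es distinct = begin
    k             ≡⟨ ℕ.+-identityʳ k ⟨
    k + 0         ≡⟨ cong (k +_) rank-⊥ ⟨
    k + rank M ⊥  ≡⟨ count-increments ⊥ es ⟩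
    rank M (union ⊥ es) ≡⟨ union-ordering es distinct ⟩
    rk M          ∎
    where
    open ≡-Reasoning
    k = count (ℕ._≟ 1) (increments ⊥ es)

  rankSequence : LinearOrdering n → RankSequence n (rk M)
  rankSequence (mkLinearOrdering π distinct) =
    mkRankSequence (increments ⊥ π) (increments-zero-one ⊥ π) (increments-ones π distinct)

  𝒢-invariant : (K : HeytingField c ℓ₁ ℓ₂) → Module.Carrierᴹ (𝒢-space K n (rk M))
  𝒢-invariant K = List.foldr _+ᴹ_ 0ᴹ (List.map (λ π → symbol K (rankSequence π)) (linearOrderings n))
    where open Module (𝒢-space K n (rk M)) using (_+ᴹ_; 0ᴹ)

-- Ground-set size and rank are not part of the configuration, so their equality
-- is asserted along with the equality of the data that they index.
SameCatenaryData : ∀ {n n′} → Matroid n → Matroid n′ → Set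
SameCatenaryData {n} {n′} M M′ =
  Σ (n ≡ n′) λ p → Σ (rk M ≡ rk M′) λ q →
    ∀ (a : Composition n′ (rk M′)) → subst₂ CatenaryData p q (catenaryData M) a ≡ catenaryData M′ a

Same𝒢 : ∀ {n n′} (K : HeytingField c ℓ₁ ℓ₂) → Matroid n → Matroid n′ → Set _
Same𝒢 {n = n} {n′} K M M′ =
  Σ (n ≡ n′) λ p → Σ (rk M ≡ rk M′) λ q →
    Module._≈ᴹ_ (𝒢-space K n′ (rk M′))
      (subst₂ (λ m r → Module.Carrierᴹ (𝒢-space K m r)) p q (𝒢-invariant M K))
      (𝒢-invariant M′ K)

-- A flat F is the disjoint union of its cyclic part W = cyc F, which is a cyclic flat, and the
-- coloops of M|F, so ∣F∣ is determined by W and the rank of F.  For cyclic flats Y ⊆ Z let A(Y,Z)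
-- be the set of flats F ⊆ Z with cyc F = Y, and S(Y,Z) the set of spanning subsets of Z that
-- contain Y.  Every X between Y and Z corresponds to a cyclic flat W, some F ∈ A(W,Z) and some
-- X ∩ W ∈ S(Y,W), where F is the closure of X and W = cyc F.  Counting by sizes, the binomial
-- coefficients are convolutions of the size distributions of A(W,Z) and S(Y,W), and induction on
-- ∣Z∣ − ∣Y∣ determines those of A(Y,Z) and S(Y,Z): the terms W = Y and W = Z yield their sum, and
-- they live in complementary ranges of sizes, because Z is not itself in A(Y,Z).
--
-- Consequently the hyperplanes of M|F with a given cyclic part are counted by cyc F and the rank
-- of F.  Flags with a given composition, and orderings with a given rank sequence (grouped by the
-- flag of closures of their initial segments), are counted by pushing weights on flats that
-- depend only on cyclic part and rank up this covering relation.

module Submission where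

open import Defs
open import Algebra.Apartness.Bundles using (HeytingField)
open import Data.Nat.Base using (ℕ)
open import Data.Product.Base using (_×_)

open import Algebra.Bundles using (CommutativeRing)
open import Algebra.Properties.CommutativeSemigroup using (interchange)
open import Algebra.Module.Bundles using (Module)
open import Data.Bool.Base using (true; false; if_then_else_)
import Data.Bool.Properties as Bool
open import Data.Empty using (⊥-elim)
open import Data.Fin.Base as Fin using (Fin; zero; suc; toℕ; fromℕ; inject₁)
import Data.Fin.Properties as Fin
open import Data.Fin.Subset
open import Data.Fin.Subset.Properties
open import Data.List.Base as List using (List; []; _∷_; filter; length; mapMaybe; allFin; cartesianProductWith)
open import Data.List.Properties using (map-tabulate)
open import Data.List.Relation.Unary.All.Properties using (all-filter)
open import Data.List.Relation.Unary.All as ListAll using ([]; _∷_)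
open import Data.Maybe.Base using (maybe′; just; nothing)
open import Data.Nat.Base hiding (ℕ; ∣_-_∣)
import Data.Nat.Properties as ℕ
open import Data.Product.Base using (∃; _,_; proj₁; proj₂)
open import Data.Sum.Base as Sum using (_⊎_; inj₁; inj₂)
open import Data.Vec.Base as Vec using (Vec; []; _∷_; lookup; tabulate)
import Data.Vec.Properties as Vec
open import Data.Vec.Relation.Unary.All as VecAll using (All; []; _∷_)
import Data.Vec.Relation.Unary.AllPairs as AllPairs
open AllPairs using ([]; _∷_)
open import Data.Vec.Relation.Unary.Unique.Propositional using (Unique)
open import Function.Base using (_∘_; id)
open import Level using (Level)
open import Relation.Binary.Morphism.Structures using (IsOrderIsomorphism)
open import Relation.Binary.PropositionalEquality hiding ([_])
open import Relation.Nullary.Decidable using (Dec; yes; no; does; ¬?; _×-dec_; decidable-stable; dec-true; dec-false)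
open import Relation.Nullary.Negation using (¬_; contradiction)

-- The number of flags above a flat F is not determined by `cyc F` and the rank of F. Take a
-- three-point line and two further points in general position in rank 3: every point has empty
-- cyclic part, yet a point on the line lies on three lines and a point off it on four. So chains
-- cannot be compared flat by flat. What can be compared is the pairing of such a count with a
-- weight that depends only on cyclic part and rank: the transpose of a step upward is a sum over
-- lower covers, and these are controlled by A(W,Z). No bijection between the flats of the two
-- matroids is ever built, only one between their cyclic flats.
--
-- Size distributions enter as sums against arbitrary functions g of the size. A convolution is then
-- a substitution into g, and the two unknown sums are told apart by setting g to zero on one side
-- of a threshold. The threshold comes from nullity: removing coloops keeps size minus rank, so for
-- Y ≠ Z a flat F in A(Y,Z) has ∣F∣ = ∣Y∣ + r(F) - r(Y) with r(F) < r(Z), whereas a spanning set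
-- needs at least r(Z) - r(Y) elements beyond Y.

private
  variable
    a p q : Level
    A B : Set a
    P : Set p
    Q : Set q
    k n n′ : ℕ

infix 4 _≟_
_≟_ : (X Y : Subset n) → Dec (X ≡ Y)
_≟_ = Vec.≡-dec Bool._≟_

-- Finite sums

when : Dec P → ℕ → ℕ
when P? x = if does P? then x else 0

when-true : (P? : Dec P) {x : ℕ} → P → when P? x ≡ x
when-true P? pr rewrite dec-true P? pr = refl

when-false : (P? : Dec P) {x : ℕ} → ¬ P → when P? x ≡ 0
when-false P? ¬pr rewrite dec-false P? ¬pr = refl

when-cong : (P? : Dec P) (Q? : Dec Q) {x y : ℕ} →
            (P → Q) → (Q → P) → (P → x ≡ y) → when P? x ≡ when Q? y
when-cong (yes pr) Q? f g eq = trans (eq pr) (sym (when-true Q? (f pr)))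
when-cong (no ¬pr) Q? f g eq = sym (when-false Q? (¬pr ∘ g))

when-congʳ : (P? : Dec P) {x y : ℕ} → (P → x ≡ y) → when P? x ≡ when P? y
when-congʳ P? = when-cong P? P? id id

when-0 : (P? : Dec P) → when P? 0 ≡ 0
when-0 (yes _) = refl
when-0 (no _)  = refl

when-× : (P? : Dec P) (Q? : Dec Q) (x : ℕ) → when (P? ×-dec Q?) x ≡ when P? (when Q? x)
when-× (yes _) Q? x = refl
when-× (no _)  Q? x = refl

when-*ʳ : (P? : Dec P) (x y : ℕ) → when P? (x * y) ≡ x * when P? y
when-*ʳ (yes _) x y = refl
when-*ʳ (no _)  x y = sym (ℕ.*-zeroʳ x)

when-*ˡ : (P? : Dec P) (x y : ℕ) → when P? (x * y) ≡ when P? x * y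
when-*ˡ (yes _) x y = refl
when-*ˡ (no _)  x y = refl

∑ : List A → (A → ℕ) → ℕ
∑ []       f = 0
∑ (x ∷ xs) f = f x + ∑ xs f

∑-cong : (xs : List A) {f g : A → ℕ} → (∀ x → f x ≡ g x) → ∑ xs f ≡ ∑ xs g
∑-cong []       eq = refl
∑-cong (x ∷ xs) eq = cong₂ _+_ (eq x) (∑-cong xs eq)

∑-zero : (xs : List A) {f : A → ℕ} → (∀ x → f x ≡ 0) → ∑ xs f ≡ 0
∑-zero []       eq = refl
∑-zero (x ∷ xs) eq = cong₂ _+_ (eq x) (∑-zero xs eq)

∑-+ : (xs : List A) (f g : A → ℕ) → ∑ xs (λ x → f x + g x) ≡ ∑ xs f + ∑ xs g
∑-+ []       f g = refl
∑-+ (x ∷ xs) f g = begin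
  (f x + g x) + ∑ xs (λ x → f x + g x) ≡⟨ cong (f x + g x +_) (∑-+ xs f g) ⟩
  (f x + g x) + (∑ xs f + ∑ xs g)      ≡⟨ interchange ℕ.+-commutativeSemigroup (f x) (g x) (∑ xs f) (∑ xs g) ⟩
  (f x + ∑ xs f) + (g x + ∑ xs g)      ∎
  where open ≡-Reasoning

∑-*ˡ : (xs : List A) (c : ℕ) (f : A → ℕ) → ∑ xs (λ x → c * f x) ≡ c * ∑ xs f
∑-*ˡ []       c f = sym (ℕ.*-zeroʳ c)
∑-*ˡ (x ∷ xs) c f = trans (cong (c * f x +_) (∑-*ˡ xs c f)) (sym (ℕ.*-distribˡ-+ c (f x) (∑ xs f)))

∑-*ʳ : (xs : List A) (f : A → ℕ) (c : ℕ) → ∑ xs (λ x → f x * c) ≡ ∑ xs f * c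
∑-*ʳ []       f c = refl
∑-*ʳ (x ∷ xs) f c = trans (cong (f x * c +_) (∑-*ʳ xs f c)) (sym (ℕ.*-distribʳ-+ c (f x) (∑ xs f)))

∑-when : (P? : Dec P) (xs : List A) (f : A → ℕ) → ∑ xs (λ x → when P? (f x)) ≡ when P? (∑ xs f)
∑-when (yes _) xs f = refl
∑-when (no _)  xs f = ∑-zero xs (λ _ → refl)

∑-swap : (xs : List A) (ys : List B) (f : A → B → ℕ) →
         ∑ xs (λ x → ∑ ys (f x)) ≡ ∑ ys (λ y → ∑ xs (λ x → f x y))
∑-swap []       ys f = sym (∑-zero ys (λ _ → refl))
∑-swap (x ∷ xs) ys f = begin
  ∑ ys (f x) + ∑ xs (λ x → ∑ ys (f x))            ≡⟨ cong (∑ ys (f x) +_) (∑-swap xs ys f) ⟩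
  ∑ ys (f x) + ∑ ys (λ y → ∑ xs (λ x → f x y))    ≡⟨ ∑-+ ys (f x) _ ⟨
  ∑ ys (λ y → f x y + ∑ xs (λ x → f x y))         ∎
  where open ≡-Reasoning

∑-map : (h : A → B) (xs : List A) (f : B → ℕ) → ∑ (List.map h xs) f ≡ ∑ xs (f ∘ h)
∑-map h []       f = refl
∑-map h (x ∷ xs) f = cong (f (h x) +_) (∑-map h xs f)

∑-++ : (xs ys : List A) (f : A → ℕ) → ∑ (xs List.++ ys) f ≡ ∑ xs f + ∑ ys f
∑-++ []       ys f = refl
∑-++ (x ∷ xs) ys f = trans (cong (f x +_) (∑-++ xs ys f)) (sym (ℕ.+-assoc (f x) _ _))

∑-vectors : (xs : List A) (k : ℕ) (f : Vec A (suc k) → ℕ) →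
            ∑ (vectors xs (suc k)) f ≡ ∑ xs (λ x → ∑ (vectors xs k) (λ v → f (x ∷ v)))
∑-vectors xs k f = go xs
  where
  vs = vectors xs k
  go : ∀ ys → ∑ (cartesianProductWith _∷_ ys vs) f ≡ ∑ ys (λ x → ∑ vs (λ v → f (x ∷ v)))
  go []       = refl
  go (y ∷ ys) = trans (∑-++ (List.map (y ∷_) vs) _ f) (cong₂ _+_ (∑-map (y ∷_) vs f) (go ys))

length-filter-∑ : {P : A → Set p} (P? : ∀ x → Dec (P x)) (xs : List A) →
                  length (filter P? xs) ≡ ∑ xs (λ x → when (P? x) 1)
length-filter-∑ P? []       = refl
length-filter-∑ P? (x ∷ xs) with does (P? x)
... | true  = cong suc (length-filter-∑ P? xs)
... | false = length-filter-∑ P? xs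

-- The enumerations are opaque so that their length can be inferred by unification.
opaque
  elements : (n : ℕ) → List (Fin n)
  elements = allFin

  elements≡allFin : (n : ℕ) → elements n ≡ allFin n
  elements≡allFin n = refl

  powerset : (n : ℕ) → List (Subset n)
  powerset = subsets

  powerset≡subsets : (n : ℕ) → powerset n ≡ subsets n
  powerset≡subsets n = refl

∑ᶠ : (Fin n → ℕ) → ℕ
∑ᶠ f = ∑ (elements _) f

∑ˢ : (Subset n → ℕ) → ℕ
∑ˢ f = ∑ (powerset _) f

opaque
  unfolding elements

  ∑ᶠ-suc : (f : Fin (suc n) → ℕ) → ∑ᶠ f ≡ f zero + ∑ᶠ (f ∘ suc)
  ∑ᶠ-suc f = cong (f zero +_)
    (trans (cong (λ xs → ∑ xs f) (sym (map-tabulate id suc))) (∑-map suc (allFin _) f))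

  ∑ᶠ-empty : (f : Fin 0 → ℕ) → ∑ᶠ f ≡ 0
  ∑ᶠ-empty f = refl

∑ᶠ-∈ : (X : Subset n) (c : ℕ) → ∑ᶠ (λ e → when (e ∈? X) c) ≡ ∣ X ∣ * c
∑ᶠ-∈ []            c = ∑ᶠ-empty (λ e → when (e ∈? []) c)
∑ᶠ-∈ (inside ∷ X)  c = trans (∑ᶠ-suc (λ e → when (e ∈? (inside ∷ X)) c))
  (cong (c +_) (trans (∑-cong (elements _) λ e → when-cong (suc e ∈? (inside ∷ X)) (e ∈? X) drop-there Vec.there λ _ → refl) (∑ᶠ-∈ X c)))
∑ᶠ-∈ (outside ∷ X) c = trans (∑ᶠ-suc (λ e → when (e ∈? (outside ∷ X)) c))
  (trans (∑-cong (elements _) λ e → when-cong (suc e ∈? (outside ∷ X)) (e ∈? X) drop-there Vec.there λ _ → refl) (∑ᶠ-∈ X c))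

opaque
  unfolding powerset

  ∑ˢ-suc : (f : Subset (suc n) → ℕ) →
           ∑ˢ f ≡ ∑ˢ (f ∘ (outside ∷_)) + ∑ˢ (f ∘ (inside ∷_))
  ∑ˢ-suc f = trans (∑-vectors (outside ∷ inside ∷ []) _ f) (cong (∑ˢ (f ∘ (outside ∷_)) +_) (ℕ.+-identityʳ _))

  ∑ˢ-empty : (f : Subset 0 → ℕ) → ∑ˢ f ≡ f []
  ∑ˢ-empty f = ℕ.+-identityʳ (f [])

∑ˢ-point : (Y : Subset n) (f : Subset n → ℕ) → ∑ˢ (λ X → when (X ≟ Y) (f X)) ≡ f Y
∑ˢ-point []            f = ∑ˢ-empty (λ X → when (X ≟ []) (f X))
∑ˢ-point (outside ∷ Y) f = begin
  ∑ˢ (λ X → when (X ≟ outside ∷ Y) (f X))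
    ≡⟨ ∑ˢ-suc _ ⟩
  ∑ˢ (λ X → when (X ≟ Y) (f (outside ∷ X))) + ∑ˢ (λ X → 0)
    ≡⟨ cong₂ _+_ (∑ˢ-point Y (f ∘ (outside ∷_))) (∑-zero (powerset _) (λ _ → refl)) ⟩
  f (outside ∷ Y) + 0
    ≡⟨ ℕ.+-identityʳ _ ⟩
  f (outside ∷ Y) ∎
  where open ≡-Reasoning
∑ˢ-point (inside ∷ Y)  f = begin
  ∑ˢ (λ X → when (X ≟ inside ∷ Y) (f X))
    ≡⟨ ∑ˢ-suc _ ⟩
  ∑ˢ (λ X → 0) + ∑ˢ (λ X → when (X ≟ Y) (f (inside ∷ X)))
    ≡⟨ cong₂ _+_ (∑-zero (powerset _) (λ _ → refl)) (∑ˢ-point Y (f ∘ (inside ∷_))) ⟩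
  f (inside ∷ Y) ∎
  where open ≡-Reasoning

∑ˢ-fibres : (φ : A → Subset n) (xs : List A) (f : A → ℕ) →
            ∑ xs f ≡ ∑ˢ (λ Y → ∑ xs (λ x → when (Y ≟ φ x) (f x)))
∑ˢ-fibres φ xs f = trans (∑-cong xs λ x → sym (∑ˢ-point (φ x) (λ _ → f x))) (∑-swap xs (powerset _) _)

-- The maps need to be mutually inverse only between `P` and `Q`, so total functions with arbitrary
-- values elsewhere can serve as the bijection.
∑ˢ-reindex : {P : Subset n → Set p} {Q : Subset n′ → Set q}
             (P? : ∀ X → Dec (P X)) (Q? : ∀ Y → Dec (Q Y))
             (φ : Subset n → Subset n′) (ψ : Subset n′ → Subset n)
             (f : Subset n → ℕ) (g : Subset n′ → ℕ) →
             (∀ X → P X → Q (φ X) × ψ (φ X) ≡ X × f X ≡ g (φ X)) →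
             (∀ Y → Q Y → P (ψ Y) × φ (ψ Y) ≡ Y) →
             ∑ˢ (λ X → when (P? X) (f X)) ≡ ∑ˢ (λ Y → when (Q? Y) (g Y))
∑ˢ-reindex P? Q? φ ψ f g to from = begin
  ∑ˢ (λ X → when (P? X) (f X))
    ≡⟨ ∑ˢ-fibres φ (powerset _) _ ⟩
  ∑ˢ (λ Y → ∑ˢ (λ X → when (Y ≟ φ X) (when (P? X) (f X))))
    ≡⟨ ∑-cong (powerset _) (λ Y → ∑-cong (powerset _) (step Y)) ⟩
  ∑ˢ (λ Y → ∑ˢ (λ X → when (X ≟ ψ Y) (when (Q? Y) (g Y))))
    ≡⟨ ∑-cong (powerset _) (λ Y → ∑ˢ-point (ψ Y) (λ _ → when (Q? Y) (g Y))) ⟩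
  ∑ˢ (λ Y → when (Q? Y) (g Y)) ∎
  where
  open ≡-Reasoning
  step : ∀ Y X → when (Y ≟ φ X) (when (P? X) (f X)) ≡ when (X ≟ ψ Y) (when (Q? Y) (g Y))
  step Y X = begin
    when (Y ≟ φ X) (when (P? X) (f X))
      ≡⟨ when-× (Y ≟ φ X) (P? X) _ ⟨
    when ((Y ≟ φ X) ×-dec P? X) (f X)
      ≡⟨ when-cong ((Y ≟ φ X) ×-dec P? X) ((X ≟ ψ Y) ×-dec Q? Y)
           (λ { (refl , pX) → let (qY , eq , _) = to X pX in sym eq , qY })
           (λ { (refl , qY) → let (pX , eq) = from Y qY in sym eq , pX })
           (λ { (refl , pX) → proj₂ (proj₂ (to X pX)) }) ⟩
    when ((X ≟ ψ Y) ×-dec Q? Y) (g Y)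
      ≡⟨ when-× (X ≟ ψ Y) (Q? Y) _ ⟩
    when (X ≟ ψ Y) (when (Q? Y) (g Y)) ∎

-- The sum of g over the sizes of the sets between two sets of sizes s and s + d.
intervalSum : ℕ → ℕ → (ℕ → ℕ) → ℕ
intervalSum zero    s g = g s
intervalSum (suc d) s g = intervalSum d s g + intervalSum d (suc s) g

intervalSum-suc : ∀ d s (g : ℕ → ℕ) → intervalSum d s (g ∘ suc) ≡ intervalSum d (suc s) g
intervalSum-suc zero    s g = refl
intervalSum-suc (suc d) s g = cong₂ _+_ (intervalSum-suc d s g) (intervalSum-suc d (suc s) g)

Between : Subset n → Subset n → Subset n → Set
Between Y Z X = Y ⊆ X × X ⊆ Z

between? : (Y Z X : Subset n) → Dec (Between Y Z X)
between? Y Z X = (Y ⊆? X) ×-dec (X ⊆? Z)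

-- A coordinate where `Y` and `Z` agree is forced in `X`. A coordinate in `Z` only is free and
-- splits the sum in two, one half with sizes shifted by 1; `intervalSum` repeats exactly this
-- splitting, so binomial coefficients never appear.
∑ˢ-between : (Y Z : Subset n) (g : ℕ → ℕ) → Y ⊆ Z →
             ∑ˢ (λ X → when (between? Y Z X) (g ∣ X ∣)) ≡ intervalSum (∣ Z ∣ ∸ ∣ Y ∣) ∣ Y ∣ g
∑ˢ-between [] [] g Y⊆Z = ∑ˢ-empty (λ X → when (between? [] [] X) (g (∣ X ∣)))
∑ˢ-between (inside ∷ Y) (outside ∷ Z) g Y⊆Z with () ← Y⊆Z Vec.here
∑ˢ-between (outside ∷ Y) (outside ∷ Z) g Y⊆Z = begin
  ∑ˢ (λ X → when (between? (outside ∷ Y) (outside ∷ Z) X) (g ∣ X ∣))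
    ≡⟨ ∑ˢ-suc (λ X → when (between? (outside ∷ Y) (outside ∷ Z) X) (g ∣ X ∣)) ⟩
  ∑ˢ (λ X → when (between? (outside ∷ Y) (outside ∷ Z) (outside ∷ X)) (g ∣ X ∣)) +
  ∑ˢ (λ X → when (between? (outside ∷ Y) (outside ∷ Z) (inside ∷ X)) (g (suc ∣ X ∣)))
    ≡⟨ cong₂ _+_
        (∑-cong (powerset _) λ X → when-cong (between? (outside ∷ Y) (outside ∷ Z) (outside ∷ X)) (between? Y Z X)
          (λ (l , r) → drop-∷-⊆ l , drop-∷-⊆ r) (λ (l , r) → s⊆s l , s⊆s r) (λ _ → refl))
        (∑-zero (powerset _) λ X → when-false (between? (outside ∷ Y) (outside ∷ Z) (inside ∷ X)) λ (l , r) → out≢in (r Vec.here)) ⟩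
  ∑ˢ (λ X → when (between? Y Z X) (g ∣ X ∣)) + 0
    ≡⟨ ℕ.+-identityʳ _ ⟩
  ∑ˢ (λ X → when (between? Y Z X) (g ∣ X ∣))
    ≡⟨ ∑ˢ-between Y Z g (drop-∷-⊆ Y⊆Z) ⟩
  intervalSum (∣ Z ∣ ∸ ∣ Y ∣) ∣ Y ∣ g ∎
  where
  open ≡-Reasoning
  out≢in : ¬ (zero ∈ outside ∷ Z)
  out≢in ()
∑ˢ-between (outside ∷ Y) (inside ∷ Z) g Y⊆Z = begin
  ∑ˢ (λ X → when (between? (outside ∷ Y) (inside ∷ Z) X) (g ∣ X ∣))
    ≡⟨ ∑ˢ-suc (λ X → when (between? (outside ∷ Y) (inside ∷ Z) X) (g ∣ X ∣)) ⟩
  ∑ˢ (λ X → when (between? (outside ∷ Y) (inside ∷ Z) (outside ∷ X)) (g ∣ X ∣)) +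
  ∑ˢ (λ X → when (between? (outside ∷ Y) (inside ∷ Z) (inside ∷ X)) (g (suc ∣ X ∣)))
    ≡⟨ cong₂ _+_
        (∑-cong (powerset _) λ X → when-cong (between? (outside ∷ Y) (inside ∷ Z) (outside ∷ X)) (between? Y Z X)
          (λ (l , r) → drop-∷-⊆ l , drop r) (λ (l , r) → s⊆s l , out⊆ r) (λ _ → refl))
        (∑-cong (powerset _) λ X → when-cong (between? (outside ∷ Y) (inside ∷ Z) (inside ∷ X)) (between? Y Z X)
          (λ (l , r) → drop l , drop-∷-⊆ r) (λ (l , r) → out⊆ l , s⊆s r) (λ _ → refl)) ⟩
  ∑ˢ (λ X → when (between? Y Z X) (g ∣ X ∣)) + ∑ˢ (λ X → when (between? Y Z X) (g (suc ∣ X ∣)))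
    ≡⟨ cong₂ _+_ (∑ˢ-between Y Z g Y⊆Z′) (trans (∑ˢ-between Y Z (g ∘ suc) Y⊆Z′) (intervalSum-suc d ∣ Y ∣ g)) ⟩
  intervalSum (suc d) (∣ Y ∣) g
    ≡⟨ cong (λ m → intervalSum m (∣ Y ∣) g) (ℕ.+-∸-assoc 1 (p⊆q⇒∣p∣≤∣q∣ Y⊆Z′)) ⟨
  intervalSum (suc ∣ Z ∣ ∸ ∣ Y ∣) (∣ Y ∣) g ∎
  where
  open ≡-Reasoning
  drop : ∀ {s} {U V : Subset n} → outside ∷ U ⊆ s ∷ V → U ⊆ V
  drop l x∈U = drop-there (l (Vec.there x∈U))
  d = ∣ Z ∣ ∸ ∣ Y ∣
  Y⊆Z′ : Y ⊆ Z
  Y⊆Z′ = drop Y⊆Z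
∑ˢ-between (inside ∷ Y) (inside ∷ Z) g Y⊆Z = begin
  ∑ˢ (λ X → when (between? (inside ∷ Y) (inside ∷ Z) X) (g ∣ X ∣))
    ≡⟨ ∑ˢ-suc (λ X → when (between? (inside ∷ Y) (inside ∷ Z) X) (g ∣ X ∣)) ⟩
  ∑ˢ (λ X → when (between? (inside ∷ Y) (inside ∷ Z) (outside ∷ X)) (g ∣ X ∣)) +
  ∑ˢ (λ X → when (between? (inside ∷ Y) (inside ∷ Z) (inside ∷ X)) (g (suc ∣ X ∣)))
    ≡⟨ cong₂ _+_
        (∑-zero (powerset _) λ X → when-false (between? (inside ∷ Y) (inside ∷ Z) (outside ∷ X)) {g (∣ X ∣)} λ (l , r) → out≢in {X = X} (l Vec.here))
        (∑-cong (powerset _) λ X → when-cong (between? (inside ∷ Y) (inside ∷ Z) (inside ∷ X)) (between? Y Z X)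
          (λ (l , r) → drop-∷-⊆ l , drop-∷-⊆ r) (λ (l , r) → s⊆s l , s⊆s r) (λ _ → refl)) ⟩
  ∑ˢ (λ X → when (between? Y Z X) (g (suc ∣ X ∣)))
    ≡⟨ ∑ˢ-between Y Z (g ∘ suc) (drop-∷-⊆ Y⊆Z) ⟩
  intervalSum (∣ Z ∣ ∸ ∣ Y ∣) ∣ Y ∣ (g ∘ suc)
    ≡⟨ intervalSum-suc (∣ Z ∣ ∸ ∣ Y ∣) ∣ Y ∣ g ⟩
  intervalSum (∣ Z ∣ ∸ ∣ Y ∣) (suc ∣ Y ∣) g ∎
  where
  open ≡-Reasoning
  out≢in : {X : Subset n} → ¬ (zero ∈ outside ∷ X)
  out≢in ()

-- Subsets

∈-─⁻ : {x : Fin n} (X Y : Subset n) → x ∈ X ─ Y → x ∈ X × x ∉ Y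
∈-─⁻ X Y x∈ = p─q⊆p X Y x∈ , λ x∈Y → excluded X Y x∈ x∈Y
  where
  excluded : {x : Fin n} (X Y : Subset n) → x ∈ X ─ Y → x ∉ Y
  excluded (_ ∷ X) (_ ∷ Y) (Vec.there x∈) (Vec.there x∈Y) = excluded X Y x∈ x∈Y

∈-remove⁻ : {x : Fin n} (X : Subset n) (e : Fin n) → x ∈ X - e → x ∈ X × x ≢ e
∈-remove⁻ X e x∈ = let (x∈X , x∉e) = ∈-─⁻ X ⁅ e ⁆ x∈ in x∈X , x∉⁅y⁆⇒x≢y x∉e

∈-insert⁻ : {x : Fin n} (X : Subset n) (e : Fin n) → x ∈ X ∪ ⁅ e ⁆ → x ∈ X ⊎ x ≡ e
∈-insert⁻ X e x∈ with x∈p∪q⁻ X ⁅ e ⁆ x∈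
... | inj₁ x∈X = inj₁ x∈X
... | inj₂ x∈e = inj₂ (x∈⁅y⁆⇒x≡y e x∈e)

∈-insert : (X : Subset n) (e : Fin n) → e ∈ X ∪ ⁅ e ⁆
∈-insert X e = q⊆p∪q X ⁅ e ⁆ (x∈⁅x⁆ e)

⊆-insert : (X : Subset n) (e : Fin n) → X ⊆ X ∪ ⁅ e ⁆
⊆-insert X e = p⊆p∪q ⁅ e ⁆

∪-lub : {X Y Z : Subset n} → X ⊆ Z → Y ⊆ Z → X ∪ Y ⊆ Z
∪-lub {X = X} {Y} X⊆Z Y⊆Z x∈ = Sum.[ X⊆Z , Y⊆Z ] (x∈p∪q⁻ X Y x∈)

insert-lub : {X Z : Subset n} {e : Fin n} → X ⊆ Z → e ∈ Z → X ∪ ⁅ e ⁆ ⊆ Z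
insert-lub {X = X} {Z} {e} X⊆Z e∈Z = ∪-lub X⊆Z λ x∈e → subst (_∈ Z) (sym (x∈⁅y⁆⇒x≡y e x∈e)) e∈Z

insert-remove : (X : Subset n) {e : Fin n} → e ∈ X → X ⊆ (X - e) ∪ ⁅ e ⁆
insert-remove X {e} e∈X {x} x∈X with x Fin.≟ e
... | yes refl = ∈-insert (X - e) e
... | no  x≢e  = ⊆-insert (X - e) e (x∈p∧x≢y⇒x∈p-y x∈X x≢e)

∉-remove : (X : Subset n) (e : Fin n) → e ∉ X - e
∉-remove X e e∈ = proj₂ (∈-remove⁻ X e e∈) refl

∣∪∣-disjoint : (X Y : Subset n) → (∀ {x} → x ∈ X → x ∉ Y) → ∣ X ∪ Y ∣ ≡ ∣ X ∣ + ∣ Y ∣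
∣∪∣-disjoint []            []            dis = refl
∣∪∣-disjoint (outside ∷ X) (outside ∷ Y) dis =
  ∣∪∣-disjoint X Y λ x∈X x∈Y → dis (Vec.there x∈X) (Vec.there x∈Y)
∣∪∣-disjoint (outside ∷ X) (inside ∷ Y)  dis = trans
  (cong suc (∣∪∣-disjoint X Y λ x∈X x∈Y → dis (Vec.there x∈X) (Vec.there x∈Y))) (sym (ℕ.+-suc _ _))
∣∪∣-disjoint (inside ∷ X)  (outside ∷ Y) dis =
  cong suc (∣∪∣-disjoint X Y λ x∈X x∈Y → dis (Vec.there x∈X) (Vec.there x∈Y))
∣∪∣-disjoint (inside ∷ X)  (inside ∷ Y)  dis = contradiction Vec.here (dis Vec.here)

∣insert∣ : (X : Subset n) {e : Fin n} → e ∉ X → ∣ X ∪ ⁅ e ⁆ ∣ ≡ suc ∣ X ∣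
∣insert∣ X {e} e∉X = begin
  ∣ X ∪ ⁅ e ⁆ ∣     ≡⟨ ∣∪∣-disjoint X ⁅ e ⁆ (λ x∈X x∈e → e∉X (subst (_∈ X) (x∈⁅y⁆⇒x≡y e x∈e) x∈X)) ⟩
  ∣ X ∣ + ∣ ⁅ e ⁆ ∣ ≡⟨ cong (∣ X ∣ +_) (∣⁅x⁆∣≡1 e) ⟩
  ∣ X ∣ + 1         ≡⟨ ℕ.+-comm ∣ X ∣ 1 ⟩
  suc ∣ X ∣         ∎
  where open ≡-Reasoning

∪-─ : {X Y : Subset n} → X ⊆ Y → X ∪ (Y ─ X) ≡ Y
∪-─ {X = X} {Y} X⊆Y = ⊆-antisym (∪-lub X⊆Y (p─q⊆p Y X)) split
  where
  split : Y ⊆ X ∪ (Y ─ X)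
  split {x} x∈Y with x ∈? X
  ... | yes x∈X = p⊆p∪q (Y ─ X) x∈X
  ... | no  x∉X = q⊆p∪q X (Y ─ X) (x∈p∧x∉q⇒x∈p─q x∈Y x∉X)

∣─∣ : {X Y : Subset n} → X ⊆ Y → ∣ Y ∣ ≡ ∣ X ∣ + ∣ Y ─ X ∣
∣─∣ {X = X} {Y} X⊆Y = trans (cong ∣_∣ (sym (∪-─ X⊆Y)))
  (∣∪∣-disjoint X (Y ─ X) λ x∈X x∈Y─X → proj₂ (∈-─⁻ Y X x∈Y─X) x∈X)

∣─∣-∸ : {X Y : Subset n} → X ⊆ Y → ∣ Y ─ X ∣ ≡ ∣ Y ∣ ∸ ∣ X ∣
∣─∣-∸ {X = X} {Y} X⊆Y = sym (trans (cong (_∸ ∣ X ∣) (∣─∣ X⊆Y)) (ℕ.m+n∸m≡n (∣ X ∣) _))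

⊆∧≢⇒∃ : {X Y : Subset n} → X ⊆ Y → X ≢ Y → ∃ λ e → e ∈ Y × e ∉ X
⊆∧≢⇒∃ {X = X} {Y} X⊆Y X≢Y with nonempty? (Y ─ X)
... | yes (e , e∈) = e , ∈-─⁻ Y X e∈
... | no  empty    = contradiction (⊆-antisym X⊆Y λ {x} x∈Y →
  decidable-stable (x ∈? X) λ x∉X → empty (x , x∈p∧x∉q⇒x∈p─q x∈Y x∉X)) X≢Y

⊆∧≢⇒⊂ : {X Y : Subset n} → X ⊆ Y → X ≢ Y → X ⊂ Y
⊆∧≢⇒⊂ X⊆Y X≢Y = X⊆Y , ⊆∧≢⇒∃ X⊆Y X≢Y

remove-mono : ∀ {X Y : Subset n} e → X ⊆ Y → X - e ⊆ Y - e
remove-mono {X = X} e X⊆Y x∈ = let (x∈X , x≢e) = ∈-remove⁻ X e x∈ in x∈p∧x≢y⇒x∈p-y (X⊆Y x∈X) x≢e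

⊆-remove : ∀ {X Y : Subset n} {e} → X ⊆ Y → e ∉ X → X ⊆ Y - e
⊆-remove X⊆Y e∉X x∈X = x∈p∧x≢y⇒x∈p-y (X⊆Y x∈X) λ { refl → e∉X x∈X }

∣remove∣ : ∀ (X : Subset n) {e} → e ∈ X → ∣ X ∣ ≡ suc ∣ X - e ∣
∣remove∣ X {e} e∈X = trans
  (cong ∣_∣ (⊆-antisym (insert-remove X e∈X) (insert-lub (p─q⊆p X ⁅ e ⁆) e∈X)))
  (∣insert∣ (X - e) (∉-remove X e))

∣─∣-shrinkˡ : ∀ {X Y Z : Subset n} → X ⊆ Y → Y ⊆ Z → Y ≢ X → ∣ Z ─ Y ∣ < ∣ Z ─ X ∣
∣─∣-shrinkˡ {X = X} {Y} {Z} X⊆Y Y⊆Z Y≢X = p⊂q⇒∣p∣<∣q∣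
  ((λ z∈ → let (z∈Z , z∉Y) = ∈-─⁻ Z Y z∈ in x∈p∧x∉q⇒x∈p─q z∈Z (z∉Y ∘ X⊆Y)) ,
   (let (e , e∈Y , e∉X) = ⊆∧≢⇒∃ X⊆Y (Y≢X ∘ sym) in
    e , x∈p∧x∉q⇒x∈p─q (Y⊆Z e∈Y) e∉X , λ e∈ → proj₂ (∈-─⁻ Z Y e∈) e∈Y))

∣─∣-shrinkʳ : ∀ {X Y Z : Subset n} → X ⊆ Y → Y ⊆ Z → Y ≢ Z → ∣ Y ─ X ∣ < ∣ Z ─ X ∣
∣─∣-shrinkʳ {X = X} {Y} {Z} X⊆Y Y⊆Z Y≢Z = p⊂q⇒∣p∣<∣q∣
  ((λ y∈ → let (y∈Y , y∉X) = ∈-─⁻ Y X y∈ in x∈p∧x∉q⇒x∈p─q (Y⊆Z y∈Y) y∉X) ,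
   (let (e , e∈Z , e∉Y) = ⊆∧≢⇒∃ Y⊆Z Y≢Z in
    e , x∈p∧x∉q⇒x∈p─q e∈Z (e∉Y ∘ X⊆Y) , λ e∈ → e∉Y (p─q⊆p Y X e∈)))

module _ {P : Fin n → Set p} (P? : ∀ e → Dec (P e)) where

  sift : Subset n
  sift = tabulate (does ∘ P?)

  ∈-sift⁺ : ∀ {e} → P e → e ∈ sift
  ∈-sift⁺ {e} pe = Vec.lookup⇒[]= e sift
    (trans (Vec.lookup∘tabulate (does ∘ P?) e) (dec-true (P? e) pe))

  ∈-sift⁻ : ∀ {e} → e ∈ sift → P e
  ∈-sift⁻ {e} e∈ = decidable-stable (P? e) λ ¬pe → Bool.not-¬
    (trans (sym (Vec.lookup∘tabulate (does ∘ P?) e)) (Vec.[]=⇒lookup e∈)) (dec-false (P? e) ¬pe)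

subset-induction : (P : Subset n → Set p) → P ⊥ →
                   (∀ e Y → e ∉ Y → P Y → P (Y ∪ ⁅ e ⁆)) → ∀ Y → P Y
subset-induction {n = n} P base step Y = go ∣ Y ∣ Y ℕ.≤-refl
  where
  go : ∀ k (Y : Subset n) → ∣ Y ∣ ≤ k → P Y
  go k Y ∣Y∣≤k with nonempty? Y
  ... | no empty = subst P (sym (Empty-unique empty)) base
  go zero    Y ∣Y∣≤0 | yes (e , e∈Y) = contradiction (ℕ.<-≤-trans (x∈p⇒∣p-x∣<∣p∣ e∈Y) ∣Y∣≤0) (λ ())
  go (suc k) Y ∣Y∣≤k | yes (e , e∈Y) =
    subst P (⊆-antisym (insert-lub (p─q⊆p Y ⁅ e ⁆) e∈Y) (insert-remove Y e∈Y))
      (step e (Y - e) (∉-remove Y e)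
        (go k (Y - e) (s≤s⁻¹ (ℕ.<-≤-trans (x∈p⇒∣p-x∣<∣p∣ e∈Y) ∣Y∣≤k))))

-- Closure and cyclic part

module MatroidTheory {n} (M : Matroid n) where

  open Matroid M using (bounded; monotone; submodular) renaming (rank to r)

  -- Inclusions in place of the union and intersection themselves spare the callers all set
  -- identities.
  submodular-⊆ : ∀ {A B C D} → D ⊆ A ∪ B → C ⊆ A → C ⊆ B → r D + r C ≤ r A + r B
  submodular-⊆ {A} {B} D⊆ C⊆A C⊆B = ℕ.≤-trans
    (ℕ.+-mono-≤ (monotone D⊆) (monotone λ x∈C → x∈p∩q⁺ (C⊆A x∈C , C⊆B x∈C)))
    (submodular A B)

  rank-∪-≤ : ∀ X Y → r (X ∪ Y) ≤ r X + ∣ Y ∣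
  rank-∪-≤ X Y = ℕ.≤-trans (ℕ.m≤m+n _ _)
    (ℕ.≤-trans (submodular X Y) (ℕ.+-monoʳ-≤ (r X) (bounded Y)))

  -- Diminishing returns: submodularity for `Y` and `X ∪ ⁅ e ⁆`, in additive form so that no
  -- truncated subtraction occurs.
  rank-insert-mono : ∀ {X Y} e → X ⊆ Y → r (Y ∪ ⁅ e ⁆) + r X ≤ r Y + r (X ∪ ⁅ e ⁆)
  rank-insert-mono {X} {Y} e X⊆Y = submodular-⊆ {Y} {X ∪ ⁅ e ⁆}
    (insert-lub (p⊆p∪q _) (q⊆p∪q Y _ (∈-insert X e))) X⊆Y (⊆-insert X e)

  rank-insert-< : ∀ {X Y} e → X ⊆ Y → r Y < r (Y ∪ ⁅ e ⁆) → r X < r (X ∪ ⁅ e ⁆)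
  rank-insert-< {X} {Y} e X⊆Y lt = ℕ.+-cancelˡ-< (r Y) (r X) (r (X ∪ ⁅ e ⁆))
    (ℕ.<-≤-trans (ℕ.+-monoˡ-< (r X) lt) (rank-insert-mono e X⊆Y))

  -- By diminishing returns each element of `Y` adds no more rank over the part already absorbed
  -- than over `X`, that is, none.
  rank-absorb : ∀ X Y → (∀ {e} → e ∈ Y → r (X ∪ ⁅ e ⁆) ≤ r X) → r (X ∪ Y) ≤ r X
  rank-absorb X = subset-induction (λ Y → (∀ {e} → e ∈ Y → r (X ∪ ⁅ e ⁆) ≤ r X) → r (X ∪ Y) ≤ r X)
    (λ _ → monotone (∪-lub {X = X} ⊆-refl ⊥⊆))
    λ e Y e∉Y ih spanned → ℕ.+-cancelʳ-≤ (r X) _ _ (begin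
      r (X ∪ (Y ∪ ⁅ e ⁆)) + r X         ≤⟨ ℕ.+-monoˡ-≤ (r X) (monotone (∪-lub (⊆-trans (p⊆p∪q Y) (p⊆p∪q ⁅ e ⁆))
                                             (insert-lub (⊆-trans (q⊆p∪q X Y) (p⊆p∪q ⁅ e ⁆)) (∈-insert (X ∪ Y) e)))) ⟩
      r ((X ∪ Y) ∪ ⁅ e ⁆) + r X         ≤⟨ rank-insert-mono e (p⊆p∪q Y) ⟩
      r (X ∪ Y) + r (X ∪ ⁅ e ⁆)         ≤⟨ ℕ.+-mono-≤ (ih (spanned ∘ ⊆-insert Y e)) (spanned (∈-insert Y e)) ⟩
      r X + r X                         ∎)
    where open ℕ.≤-Reasoning

  rank-insert-∈ : ∀ {X e} → e ∈ X → r (X ∪ ⁅ e ⁆) ≤ r X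
  rank-insert-∈ e∈X = monotone (insert-lub ⊆-refl e∈X)

  spanned? : ∀ X e → Dec (r (X ∪ ⁅ e ⁆) ≤ r X)
  spanned? X e = r (X ∪ ⁅ e ⁆) ℕ.≤? r X

  cl : Subset n → Subset n
  cl X = sift (spanned? X)

  ⊆-cl : ∀ X → X ⊆ cl X
  ⊆-cl X e∈X = ∈-sift⁺ (spanned? X) (rank-insert-∈ e∈X)

  ∈-cl⁻ : ∀ {X e} → e ∈ cl X → r (X ∪ ⁅ e ⁆) ≤ r X
  ∈-cl⁻ {X} = ∈-sift⁻ (spanned? X)

  ∉-cl⁻ : ∀ {X e} → e ∉ cl X → r X < r (X ∪ ⁅ e ⁆)
  ∉-cl⁻ {X} e∉ = ℕ.≰⇒> (e∉ ∘ ∈-sift⁺ (spanned? X))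

  rank-cl : ∀ X → r (cl X) ≡ r X
  rank-cl X = ℕ.≤-antisym
    (ℕ.≤-trans (monotone (q⊆p∪q X (cl X))) (rank-absorb X (cl X) ∈-cl⁻))
    (monotone (⊆-cl X))

  cl-flat : ∀ X → IsFlat M (cl X)
  cl-flat X e e∉ = begin-strict
    r (cl X)            ≡⟨ rank-cl X ⟩
    r X                 <⟨ ∉-cl⁻ e∉ ⟩
    r (X ∪ ⁅ e ⁆)       ≤⟨ monotone (insert-lub (⊆-trans (⊆-cl X) (⊆-insert (cl X) e)) (∈-insert (cl X) e)) ⟩
    r (cl X ∪ ⁅ e ⁆)    ∎
    where open ℕ.≤-Reasoning

  cl-least : ∀ {X F} → IsFlat M F → X ⊆ F → cl X ⊆ F
  cl-least {X} {F} flat X⊆F {e} e∈cl = decidable-stable (e ∈? F) λ e∉F →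
    ℕ.<⇒≱ (rank-insert-< e X⊆F (flat e e∉F)) (∈-cl⁻ e∈cl)

  cl-unique : ∀ {X F} → IsFlat M F → X ⊆ F → r F ≤ r X → F ≡ cl X
  cl-unique {X} {F} flat X⊆F rF≤rX = ⊆-antisym
    (λ e∈F → ∈-sift⁺ (spanned? X) (ℕ.≤-trans (monotone (insert-lub X⊆F e∈F)) rF≤rX))
    (cl-least flat X⊆F)

  flat-≡ : ∀ {F G} → IsFlat M F → IsFlat M G → G ⊆ F → r F ≤ r G → F ≡ G
  flat-≡ flatF flatG G⊆F rF≤rG = trans (cl-unique flatF G⊆F rF≤rG) (sym (cl-unique flatG ⊆-refl ℕ.≤-refl))

  flat-∩ : ∀ {F G} → IsFlat M F → IsFlat M G → IsFlat M (F ∩ G)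
  flat-∩ {F} {G} flatF flatG e e∉ with e ∈? F
  ... | no  e∉F = rank-insert-< e (p∩q⊆p F G) (flatF e e∉F)
  ... | yes e∈F = rank-insert-< e (p∩q⊆q F G) (flatG e λ e∈G → e∉ (x∈p∩q⁺ (e∈F , e∈G)))

  nonColoop? : ∀ X e → Dec (e ∈ X × r X ≤ r (X - e))
  nonColoop? X e = (e ∈? X) ×-dec (r X ℕ.≤? r (X - e))

  -- The union of the circuits contained in X.
  cyc : Subset n → Subset n
  cyc X = sift (nonColoop? X)

  ∈-cyc⁺ : ∀ {X e} → e ∈ X → r X ≤ r (X - e) → e ∈ cyc X
  ∈-cyc⁺ {X} e∈X le = ∈-sift⁺ (nonColoop? X) (e∈X , le)

  ∈-cyc⁻ : ∀ {X e} → e ∈ cyc X → r X ≤ r (X - e)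
  ∈-cyc⁻ {X} e∈ = proj₂ (∈-sift⁻ (nonColoop? X) e∈)

  cyc⊆ : ∀ X → cyc X ⊆ X
  cyc⊆ X e∈ = proj₁ (∈-sift⁻ (nonColoop? X) e∈)

  -- Submodularity for `Y - e` and `X`, whose union is all of `Y` because `e` lies in `X`. It makes
  -- a coloop of M|Y that lies in `X` a coloop of M|X.
  rank-remove-mono : ∀ {X Y} e → X ⊆ Y → e ∈ X → r Y + r (X - e) ≤ r (Y - e) + r X
  rank-remove-mono {X} {Y} e X⊆Y e∈X = submodular-⊆ {Y - e} {X}
    (λ x∈Y → insert-lub (p⊆p∪q X) (q⊆p∪q (Y - e) X e∈X) (insert-remove Y (X⊆Y e∈X) x∈Y))
    (remove-mono e X⊆Y) (p─q⊆p X ⁅ e ⁆)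

  cyc-mono : ∀ {X Y} → X ⊆ Y → cyc X ⊆ cyc Y
  cyc-mono {X} {Y} X⊆Y {e} e∈ = ∈-cyc⁺ (X⊆Y (cyc⊆ X e∈)) (ℕ.+-cancelʳ-≤ (r X) _ _ (begin
    r Y + r X         ≤⟨ ℕ.+-monoʳ-≤ (r Y) (∈-cyc⁻ e∈) ⟩
    r Y + r (X - e)   ≤⟨ rank-remove-mono e X⊆Y (cyc⊆ X e∈) ⟩
    r (Y - e) + r X   ∎))
    where open ℕ.≤-Reasoning

  -- A coloop of M|X raises the rank of every subset of `X` that misses it, so inserting the
  -- elements of `D` one at a time gains 1 each; the other bound is the general one for unions.
  rank-∪-coloops : ∀ X {Y} D → Y ⊆ X → D ⊆ X → (∀ {e} → e ∈ D → r (X - e) < r X) →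
                   (∀ {e} → e ∈ D → e ∉ Y) → r (Y ∪ D) ≡ r Y + ∣ D ∣
  rank-∪-coloops X {Y} D Y⊆X D⊆X coloop dis = ℕ.≤-antisym (rank-∪-≤ Y D) (lower D D⊆X coloop dis)
    where
    open ℕ.≤-Reasoning
    lower : ∀ D → D ⊆ X → (∀ {e} → e ∈ D → r (X - e) < r X) →
            (∀ {e} → e ∈ D → e ∉ Y) → r Y + ∣ D ∣ ≤ r (Y ∪ D)
    lower = subset-induction _
      (λ _ _ _ → begin
        r Y + ∣ ⊥ {n} ∣ ≡⟨ cong (r Y +_) (∣⊥∣≡0 n) ⟩
        r Y + 0         ≡⟨ ℕ.+-identityʳ _ ⟩
        r Y             ≤⟨ monotone (p⊆p∪q ⊥) ⟩
        r (Y ∪ ⊥)       ∎)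
      λ e D e∉D ih D⊆X coloop dis →
        let D⊆De  = ⊆-insert D e
            e∈De  = ∈-insert D e
            YD⊆X  = ∪-lub Y⊆X (⊆-trans D⊆De D⊆X)
            e∉YD  = λ e∈YD → Sum.[ dis e∈De , e∉D ] (x∈p∪q⁻ Y D e∈YD)
        in begin
        r Y + ∣ D ∪ ⁅ e ⁆ ∣  ≡⟨ cong (r Y +_) (∣insert∣ D e∉D) ⟩
        r Y + suc ∣ D ∣      ≡⟨ ℕ.+-suc (r Y) ∣ D ∣ ⟩
        suc (r Y + ∣ D ∣)    ≤⟨ s≤s (ih (⊆-trans D⊆De D⊆X) (coloop ∘ D⊆De) (dis ∘ D⊆De)) ⟩
        suc (r (Y ∪ D))      ≤⟨ rank-insert-< e (⊆-remove YD⊆X e∉YD) (ℕ.<-≤-trans (coloop e∈De)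
                                  (monotone (insert-remove X (D⊆X e∈De)))) ⟩
        r ((Y ∪ D) ∪ ⁅ e ⁆)  ≤⟨ monotone (insert-lub (∪-lub (p⊆p∪q _) (⊆-trans D⊆De (q⊆p∪q Y _))) (q⊆p∪q Y _ e∈De)) ⟩
        r (Y ∪ (D ∪ ⁅ e ⁆))  ∎

  coloop-rank : ∀ {X e} → e ∈ X → e ∉ cyc X → r (X - e) < r X
  coloop-rank e∈X e∉cyc = ℕ.≰⇒> (e∉cyc ∘ ∈-cyc⁺ e∈X)

  rank-cyc : ∀ X → r X ≡ r (cyc X) + ∣ X ─ cyc X ∣
  rank-cyc X = trans (cong r (sym (∪-─ (cyc⊆ X))))
    (rank-∪-coloops X (X ─ cyc X) (cyc⊆ X) (p─q⊆p X (cyc X))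
      (λ e∈ → let (e∈X , e∉) = ∈-─⁻ X (cyc X) e∈ in coloop-rank e∈X e∉)
      (λ e∈ → proj₂ (∈-─⁻ X (cyc X) e∈)))

  -- Only coloops are removed, so `X` and `cyc X` have the same nullity; this is that equation
  -- without subtraction.
  rank-size-cyc : ∀ X → r X + ∣ cyc X ∣ ≡ r (cyc X) + ∣ X ∣
  rank-size-cyc X = begin
    r X + ∣ cyc X ∣                              ≡⟨ cong (_+ ∣ cyc X ∣) (rank-cyc X) ⟩
    r (cyc X) + ∣ X ─ cyc X ∣ + ∣ cyc X ∣        ≡⟨ ℕ.+-assoc (r (cyc X)) _ _ ⟩
    r (cyc X) + (∣ X ─ cyc X ∣ + ∣ cyc X ∣)      ≡⟨ cong (r (cyc X) +_) (ℕ.+-comm (∣ X ─ cyc X ∣) _) ⟩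
    r (cyc X) + (∣ cyc X ∣ + ∣ X ─ cyc X ∣)      ≡⟨ cong (r (cyc X) +_) (∣─∣ (cyc⊆ X)) ⟨
    r (cyc X) + ∣ X ∣                            ∎
    where open ≡-Reasoning

  -- The coloops contribute their full number to the rank of `X` and at most that number to the rank
  -- of `X - e`. Cancelling them shows that `e` is a coloop of neither M|X nor M|cyc X.
  ⊆-cyc-cyc : ∀ X → cyc X ⊆ cyc (cyc X)
  ⊆-cyc-cyc X {e} e∈ = ∈-cyc⁺ e∈ (ℕ.+-cancelʳ-≤ ∣ X ─ cyc X ∣ _ _ (begin
    r (cyc X) + ∣ X ─ cyc X ∣        ≡⟨ rank-cyc X ⟨
    r X                              ≤⟨ ∈-cyc⁻ e∈ ⟩
    r (X - e)                        ≤⟨ monotone split ⟩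
    r ((cyc X - e) ∪ (X ─ cyc X))    ≤⟨ rank-∪-≤ (cyc X - e) (X ─ cyc X) ⟩
    r (cyc X - e) + ∣ X ─ cyc X ∣    ∎))
    where
    open ℕ.≤-Reasoning
    split : X - e ⊆ (cyc X - e) ∪ (X ─ cyc X)
    split {x} x∈ with ∈-remove⁻ X e x∈ | x ∈? cyc X
    ... | x∈X , x≢e | yes x∈cyc = p⊆p∪q _ (x∈p∧x≢y⇒x∈p-y x∈cyc x≢e)
    ... | x∈X , x≢e | no  x∉cyc = q⊆p∪q (cyc X - e) _ (x∈p∧x∉q⇒x∈p─q x∈X x∉cyc)

  -- A point outside `cyc F` is either outside the flat `F` or a coloop of M|F; both kinds raise the
  -- rank of `cyc F`.
  cyc-flat : ∀ {F} → IsFlat M F → IsFlat M (cyc F)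
  cyc-flat {F} flat e e∉ with e ∈? F
  ... | no  e∉F = rank-insert-< e (cyc⊆ F) (flat e e∉F)
  ... | yes e∈F = rank-insert-< e (⊆-remove (cyc⊆ F) e∉)
    (ℕ.<-≤-trans (coloop-rank e∈F e∉) (monotone (insert-remove F e∈F)))

  -- Cyclic flats

  independent-⊆ : ∀ {X Y} → X ⊆ Y → IsIndependent M Y → IsIndependent M X
  independent-⊆ {X} {Y} X⊆Y indY = ℕ.≤-antisym (bounded X) (ℕ.+-cancelʳ-≤ ∣ Y ─ X ∣ _ _ (begin
    ∣ X ∣ + ∣ Y ─ X ∣  ≡⟨ ∣─∣ X⊆Y ⟨
    ∣ Y ∣              ≡⟨ indY ⟨
    r Y                ≡⟨ cong r (∪-─ X⊆Y) ⟨
    r (X ∪ (Y ─ X))    ≤⟨ rank-∪-≤ X (Y ─ X) ⟩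
    r X + ∣ Y ─ X ∣    ∎))
    where open ℕ.≤-Reasoning

  coloops⇒independent : ∀ {X} → (∀ {e} → e ∈ X → r (X - e) < r X) → IsIndependent M X
  coloops⇒independent {X} coloop = begin
    r X             ≡⟨ cong r (⊆-antisym (q⊆p∪q ⊥ X) (∪-lub ⊥⊆ ⊆-refl)) ⟩
    r (⊥ ∪ X)       ≡⟨ rank-∪-coloops X X ⊥⊆ ⊆-refl coloop (λ _ → ∉⊥) ⟩
    r ⊥ + ∣ X ∣     ≡⟨ cong (_+ ∣ X ∣) (rank-⊥ M) ⟩
    ∣ X ∣           ∎
    where open ≡-Reasoning

  circuit⊆cyc : ∀ {C} → IsCircuit M C → C ⊆ cyc C
  circuit⊆cyc {C} (dependent , minimal) {e} e∈C = ∈-cyc⁺ e∈C (begin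
    r C          ≤⟨ s≤s⁻¹ (ℕ.<-≤-trans (ℕ.≤∧≢⇒< (bounded C) dependent) (ℕ.≤-reflexive (∣remove∣ C e∈C))) ⟩
    ∣ C - e ∣    ≡⟨ minimal (C - e) (x∈p⇒p-x⊂p e∈C) ⟨
    r (C - e)    ∎)
    where open ℕ.≤-Reasoning

  ⋃-circuits⊆cyc : ∀ {Cs} → ListAll.All (IsCircuit M) Cs → ⋃ Cs ⊆ cyc (⋃ Cs)
  ⋃-circuits⊆cyc []                    x∈ = contradiction x∈ ∉⊥
  ⋃-circuits⊆cyc {C ∷ Cs} (circ ∷ circs) x∈ with x∈p∪q⁻ C (⋃ Cs) x∈
  ... | inj₁ x∈C = cyc-mono (p⊆p∪q (⋃ Cs)) (circuit⊆cyc circ x∈C)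
  ... | inj₂ x∈⋃ = cyc-mono (q⊆p∪q C (⋃ Cs)) (⋃-circuits⊆cyc circs x∈⋃)

  cyclic⇒⊆cyc : ∀ {X} → IsCyclic M X → X ⊆ cyc X
  cyclic⇒⊆cyc (Cs , circs , refl) = ⋃-circuits⊆cyc circs

  -- A minimal X with e ∈ cyc X is a circuit.
  circuitThrough : ∀ k X {e} → ∣ X ∣ ≤ k → e ∈ cyc X → ∃ λ C → IsCircuit M C × C ⊆ X × e ∈ C
  circuitThrough k X {e} ∣X∣≤k e∈ with Fin.any? (λ f → (e ∈? cyc (X - f)) ×-dec (f ∈? X))
  circuitThrough zero X ∣X∣≤k e∈ | yes (f , _ , f∈X) =
    contradiction (ℕ.≤-trans (ℕ.≤-reflexive (sym (∣remove∣ X f∈X))) ∣X∣≤k) λ ()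
  circuitThrough (suc k) X ∣X∣≤k e∈ | yes (f , e∈′ , f∈X)
    with C , circ , C⊆ , e∈C ← circuitThrough k (X - f)
           (s≤s⁻¹ (ℕ.≤-trans (ℕ.≤-reflexive (sym (∣remove∣ X f∈X))) ∣X∣≤k)) e∈′
    = C , circ , ⊆-trans C⊆ (p─q⊆p X ⁅ f ⁆) , e∈C
  circuitThrough k X {e} ∣X∣≤k e∈ | no minimal = X , (dependent , independent) , ⊆-refl , cyc⊆ X e∈
    where
    open ℕ.≤-Reasoning
    e∈X = cyc⊆ X e∈
    lost : ∀ {f} → f ∈ X → f ≢ e → r ((X - f) - e) < r (X - f)
    lost {f} f∈X f≢e = coloop-rank (x∈p∧x≢y⇒x∈p-y e∈X (f≢e ∘ sym)) λ e∈′ → minimal (f , e∈′ , f∈X)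
    -- By minimality `e` becomes a coloop once any other `f` is deleted. As deleting `e` from `X`
    -- itself costs no rank, every such `f` is a coloop of M|(X - e).
    independent-e : IsIndependent M (X - e)
    independent-e = coloops⇒independent λ {f} f∈ → let (f∈X , f≢e) = ∈-remove⁻ X e f∈ in begin-strict
      r ((X - e) - f)   ≡⟨ cong r (p─x─y≡p─y─x X e f) ⟩
      r ((X - f) - e)   <⟨ lost f∈X f≢e ⟩
      r (X - f)         ≤⟨ monotone (p─q⊆p X ⁅ f ⁆) ⟩
      r X               ≤⟨ ∈-cyc⁻ e∈ ⟩
      r (X - e)         ∎
    dependent : ¬ IsIndependent M X
    dependent ind = ℕ.<⇒≱ (ℕ.≤-<-trans (∈-cyc⁻ e∈) (ℕ.≤-<-trans (bounded (X - e))
      (ℕ.≤-reflexive (sym (∣remove∣ X e∈X))))) (ℕ.≤-reflexive (sym ind))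
    independent-f : ∀ {f} → f ∈ X → IsIndependent M (X - f)
    independent-f {f} f∈X with f Fin.≟ e
    ... | yes refl = independent-e
    ... | no  f≢e  = ℕ.≤-antisym (bounded (X - f)) (begin
      ∣ X - f ∣               ≡⟨ ∣remove∣ (X - f) (x∈p∧x≢y⇒x∈p-y e∈X (f≢e ∘ sym)) ⟩
      suc ∣ (X - f) - e ∣     ≡⟨ cong (suc ∘ ∣_∣) (p─x─y≡p─y─x X f e) ⟩
      suc ∣ (X - e) - f ∣     ≡⟨ cong suc (independent-⊆ (p─q⊆p (X - e) ⁅ f ⁆) independent-e) ⟨
      suc (r ((X - e) - f))   ≡⟨ cong (suc ∘ r) (p─x─y≡p─y─x X e f) ⟩
      suc (r ((X - f) - e))   ≤⟨ lost f∈X f≢e ⟩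
      r (X - f)               ∎)
    independent : ∀ D → D ⊂ X → IsIndependent M D
    independent D (D⊆X , f , f∈X , f∉D) = independent-⊆ (⊆-remove D⊆X f∉D) (independent-f f∈X)

  ⊆cyc⇒cyclic : ∀ {X} → X ⊆ cyc X → IsCyclic M X
  ⊆cyc⇒cyclic {X} X⊆cyc =
    let (Cs , circs , Cs⊆ , cover) = go X X⊆cyc in Cs , circs , ⊆-antisym cover Cs⊆
    where
    go : ∀ Y → Y ⊆ cyc X → ∃ λ Cs → ListAll.All (IsCircuit M) Cs × ⋃ Cs ⊆ X × Y ⊆ ⋃ Cs
    go = subset-induction _ (λ _ → [] , [] , ⊥⊆ , ⊥⊆)
      λ e Y _ ih Ye⊆ →
        let (Cs , circs , Cs⊆ , cover) = ih (⊆-trans (⊆-insert Y e) Ye⊆)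
            (C , circ , C⊆ , e∈C) = circuitThrough ∣ X ∣ X ℕ.≤-refl (Ye⊆ (∈-insert Y e))
        in C ∷ Cs , circ ∷ circs , ∪-lub C⊆ Cs⊆ , insert-lub (⊆-trans cover (q⊆p∪q C _)) (p⊆p∪q _ e∈C)

  -- A decidable form, in terms of rank, of being a cyclic flat; `cyclic⇒⊆cyc` and `⊆cyc⇒cyclic`
  -- relate it to unions of circuits.
  CyclicFlatSet : Subset n → Set
  CyclicFlatSet Z = IsFlat M Z × Z ⊆ cyc Z

  cyclicFlat? : ∀ Z → Dec (CyclicFlatSet Z)
  cyclicFlat? Z = isFlat? M Z ×-dec (Z ⊆? cyc Z)

  cyc-≡ : ∀ {Z} → CyclicFlatSet Z → cyc Z ≡ Z
  cyc-≡ {Z} (_ , Z⊆) = ⊆-antisym (cyc⊆ Z) Z⊆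

  cyc-cyclicFlat : ∀ {F} → IsFlat M F → CyclicFlatSet (cyc F)
  cyc-cyclicFlat {F} flat = cyc-flat flat , ⊆-cyc-cyc F

  ⊆-cyc : ∀ {Z F} → CyclicFlatSet Z → Z ⊆ F → Z ⊆ cyc F
  ⊆-cyc (_ , Z⊆) Z⊆F = ⊆-trans Z⊆ (cyc-mono Z⊆F)

  ⊤-flat : IsFlat M ⊤
  ⊤-flat e e∉ = contradiction ∈⊤ e∉

  -- A basis that misses `e` lies in `⊤ - e` and has full rank. So an `e` whose deletion lowers the
  -- rank is in every basis.
  ⊤-cyclicFlat : NoColoops M → CyclicFlatSet ⊤
  ⊤-cyclicFlat noColoops = ⊤-flat , λ {e} _ → ∈-cyc⁺ ∈⊤ (ℕ.≮⇒≥ λ lt →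
    noColoops e λ B (indB , maximal) → decidable-stable (e ∈? B) λ e∉B →
      ℕ.<⇒≱ lt (begin
        r ⊤         ≤⟨ monotone (q⊆p∪q B ⊤) ⟩
        r (B ∪ ⊤)   ≤⟨ rank-absorb B ⊤ (λ {f} _ → spans indB maximal f) ⟩
        r B         ≤⟨ monotone (⊆-remove ⊆⊤ e∉B) ⟩
        r (⊤ - e)   ∎))
    where
    open ℕ.≤-Reasoning
    spans : ∀ {B} → IsIndependent M B → (∀ I → IsIndependent M I → ¬ (B ⊂ I)) →
            ∀ f → r (B ∪ ⁅ f ⁆) ≤ r B
    spans {B} indB maximal f with f ∈? B
    ... | yes f∈B = rank-insert-∈ f∈B
    ... | no  f∉B = ℕ.≮⇒≥ λ lt → maximal (B ∪ ⁅ f ⁆)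
      (ℕ.≤-antisym (bounded _) (begin
        ∣ B ∪ ⁅ f ⁆ ∣   ≡⟨ ∣insert∣ B f∉B ⟩
        suc ∣ B ∣       ≡⟨ cong suc indB ⟨
        suc (r B)       ≤⟨ lt ⟩
        r (B ∪ ⁅ f ⁆)   ∎))
      (⊆-insert B f , f , ∈-insert B f , f∉B)

  -- Flats and spanning sets over a cyclic flat

  FlatIn : Subset n → Subset n → Subset n → Set
  FlatIn W Z F = IsFlat M F × F ⊆ Z × cyc F ≡ W

  flatIn? : ∀ W Z F → Dec (FlatIn W Z F)
  flatIn? W Z F = isFlat? M F ×-dec (F ⊆? Z) ×-dec (cyc F ≟ W)

  -- The size distribution of the set A(W,Z), tested against `g`; an indicator for `g` gives the
  -- number of its flats of one size. `∑-spanning` does the same for S(Y,Z).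
  ∑-flats : Subset n → Subset n → (ℕ → ℕ) → ℕ
  ∑-flats W Z g = ∑ˢ (λ F → when (flatIn? W Z F) (g (∣ F ∣)))

  Spanning : Subset n → Subset n → Subset n → Set
  Spanning Y Z X = Between Y Z X × r Z ≤ r X

  spanning? : ∀ Y Z X → Dec (Spanning Y Z X)
  spanning? Y Z X = between? Y Z X ×-dec (r Z ℕ.≤? r X)

  ∑-spanning : Subset n → Subset n → (ℕ → ℕ) → ℕ
  ∑-spanning Y Z g = ∑ˢ (λ X → when (spanning? Y Z X) (g (∣ X ∣)))

  module Coloops {F : Subset n} (flatF : IsFlat M F) where

    private
      W = cyc F

    C : Subset n
    C = F ─ W

    C⊆F : C ⊆ F
    C⊆F = p─q⊆p F W

    C∉W : ∀ {x} → x ∈ C → x ∉ W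
    C∉W x∈C = proj₂ (∈-─⁻ F W x∈C)

    C-coloop : ∀ {e} → e ∈ C → r (F - e) < r F
    C-coloop e∈C = let (e∈F , e∉W) = ∈-─⁻ F W e∈C in coloop-rank e∈F e∉W

    ∣C∣ : ∣ C ∣ ≡ ∣ F ∣ ∸ ∣ W ∣
    ∣C∣ = ∣─∣-∸ (cyc⊆ F)

    ∣∪C∣ : ∀ {X} → X ⊆ W → ∣ X ∪ C ∣ ≡ ∣ X ∣ + (∣ F ∣ ∸ ∣ W ∣)
    ∣∪C∣ {X} X⊆W = trans (∣∪∣-disjoint X C λ x∈X x∈C → C∉W x∈C (X⊆W x∈X)) (cong (∣ X ∣ +_) ∣C∣)

    ∪C-∩W : ∀ {H X} → H ⊆ W → H ⊆ X → X ⊆ H ∪ C → X ∩ W ≡ H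
    ∪C-∩W {H} {X} H⊆W H⊆X X⊆ = ⊆-antisym
      (λ x∈ → let (x∈X , x∈W) = x∈p∩q⁻ X W x∈ in
        Sum.[ id , (λ x∈C → contradiction x∈W (C∉W x∈C)) ] (x∈p∪q⁻ H C (X⊆ x∈X)))
      (λ x∈H → x∈p∩q⁺ (H⊆X x∈H , H⊆W x∈H))

    ⊆-∩W∪C : ∀ {X} → X ⊆ F → X ⊆ (X ∩ W) ∪ C
    ⊆-∩W∪C {X} X⊆F {x} x∈X with x ∈? W
    ... | yes x∈W = p⊆p∪q C (x∈p∩q⁺ (x∈X , x∈W))
    ... | no  x∉W = q⊆p∪q (X ∩ W) C (x∈p∧x∉q⇒x∈p─q (X⊆F x∈X) x∉W)

    -- If `X` missed a coloop `e` of M|F, it would lie in `F - e`, which has smaller rank than `F`.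
    C⊆spanning : ∀ {X} → F ≡ cl X → C ⊆ X
    C⊆spanning {X} F≡clX {e} e∈C = decidable-stable (e ∈? X) λ e∉X → ℕ.<⇒≱ (C-coloop e∈C) (begin
      r F          ≡⟨ cong r F≡clX ⟩
      r (cl X)     ≡⟨ rank-cl X ⟩
      r X          ≤⟨ monotone (⊆-remove (subst (X ⊆_) (sym F≡clX) (⊆-cl X)) e∉X) ⟩
      r (F - e)    ∎)
      where open ℕ.≤-Reasoning

    -- A set with closure `F` consists of `C` and a spanning set of `W`, and any such union has
    -- closure `F`. The shift of the sizes is the size of `C`.
    ∑-closure : ∀ {Y Z} (g : ℕ → ℕ) → Y ⊆ W → F ⊆ Z →
                ∑ˢ (λ X → when ((F ≟ cl X) ×-dec between? Y Z X) (g (∣ X ∣)))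
                  ≡ ∑-spanning Y W (λ t → g (t + (∣ F ∣ ∸ ∣ W ∣)))
    ∑-closure {Y} {Z} g Y⊆W F⊆Z = ∑ˢ-reindex (λ X → (F ≟ cl X) ×-dec between? Y Z X) (spanning? Y W) (_∩ W) (_∪ C) _ _ to from
      where
      open ℕ.≤-Reasoning
      to : ∀ X → F ≡ cl X × Between Y Z X →
           Spanning Y W (X ∩ W) × (X ∩ W) ∪ C ≡ X × g (∣ X ∣) ≡ g (∣ X ∩ W ∣ + (∣ F ∣ ∸ ∣ W ∣))
      to X (F≡clX , Y⊆X , X⊆Z) =
        (((λ y∈ → x∈p∩q⁺ (Y⊆X y∈ , Y⊆W y∈)) , p∩q⊆q X W) , spans) , glue ,
        cong g (trans (cong ∣_∣ (sym glue)) (∣∪C∣ (p∩q⊆q X W)))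
        where
        X⊆F : X ⊆ F
        X⊆F = subst (X ⊆_) (sym F≡clX) (⊆-cl X)
        glue : (X ∩ W) ∪ C ≡ X
        glue = ⊆-antisym (∪-lub (p∩q⊆p X W) (C⊆spanning F≡clX)) (⊆-∩W∪C X⊆F)
        spans : r W ≤ r (X ∩ W)
        spans = ℕ.+-cancelʳ-≤ ∣ C ∣ _ _ (begin
          r W + ∣ C ∣         ≡⟨ rank-cyc F ⟨
          r F                 ≡⟨ cong r F≡clX ⟩
          r (cl X)            ≡⟨ rank-cl X ⟩
          r X                 ≡⟨ cong r glue ⟨
          r ((X ∩ W) ∪ C)     ≤⟨ rank-∪-≤ (X ∩ W) C ⟩
          r (X ∩ W) + ∣ C ∣   ∎)
      from : ∀ X → Spanning Y W X → (F ≡ cl (X ∪ C) × Between Y Z (X ∪ C)) × (X ∪ C) ∩ W ≡ X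
      from X ((Y⊆X , X⊆W) , spans) =
        (cl-unique flatF X∪C⊆F (begin
          r F              ≡⟨ rank-cyc F ⟩
          r W + ∣ C ∣      ≤⟨ ℕ.+-monoˡ-≤ ∣ C ∣ spans ⟩
          r X + ∣ C ∣      ≡⟨ rank-∪-coloops F C (⊆-trans X⊆W (cyc⊆ F)) C⊆F C-coloop
                               (λ e∈C e∈X → C∉W e∈C (X⊆W e∈X)) ⟨
          r (X ∪ C)        ∎)
        , ⊆-trans Y⊆X (p⊆p∪q C) , ⊆-trans X∪C⊆F F⊆Z)
        , ∪C-∩W X⊆W (p⊆p∪q C) ⊆-refl
        where
        X∪C⊆F : X ∪ C ⊆ F
        X∪C⊆F = ∪-lub (⊆-trans X⊆W (cyc⊆ F)) C⊆F

    restrict : ∀ {V G} → FlatIn V F G → FlatIn V W (G ∩ W) × Between (G ∩ W) ((G ∩ W) ∪ C) G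
    restrict {V} {G} (flatG , G⊆F , cycG≡V) =
      (flat-∩ flatG (cyc-flat flatF) , p∩q⊆q G W ,
        trans (⊆-antisym (cyc-mono (p∩q⊆p G W)) (⊆-trans (⊆-cyc-cyc G) (cyc-mono cycG⊆))) cycG≡V) ,
      p∩q⊆p G W , ⊆-∩W∪C G⊆F
      where
      cycG⊆ : cyc G ⊆ G ∩ W
      cycG⊆ x∈ = x∈p∩q⁺ (cyc⊆ G x∈ , cyc-mono G⊆F x∈)

    extend : ∀ {V H G} → FlatIn V W H → Between H (H ∪ C) G → H ≡ G ∩ W × FlatIn V F G
    extend {V} {H} {G} (flatH , H⊆W , cycH≡V) (H⊆G , G⊆) =
      sym G∩W≡H , flatG , G⊆F ,
      trans (⊆-antisym (⊆-trans (⊆-cyc-cyc G) (cyc-mono cycG⊆H)) (cyc-mono H⊆G)) cycH≡V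
      where
      open ℕ.≤-Reasoning
      H⊆F = ⊆-trans H⊆W (cyc⊆ F)
      G∩W≡H : G ∩ W ≡ H
      G∩W≡H = ∪C-∩W H⊆W H⊆G G⊆
      G⊆F : G ⊆ F
      G⊆F = ⊆-trans G⊆ (∪-lub H⊆F C⊆F)
      cycG⊆H : cyc G ⊆ H
      cycG⊆H x∈ = subst (_ ∈_) G∩W≡H (x∈p∩q⁺ (cyc⊆ G x∈ , cyc-mono G⊆F x∈))
      D = G ─ H
      D⊆C : D ⊆ C
      D⊆C x∈D = let (x∈G , x∉H) = ∈-─⁻ G H x∈D in
        Sum.[ (λ x∈H → contradiction x∈H x∉H) , id ] (x∈p∪q⁻ H C (G⊆ x∈G))
      flatG : IsFlat M G
      flatG e e∉G with e ∈? F
      ... | no e∉F = rank-insert-< e G⊆F (flatF e e∉F)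
      ... | yes e∈F with e ∈? W
      ... | no e∉W = rank-insert-< e (⊆-remove G⊆F e∉G)
        (ℕ.<-≤-trans (coloop-rank e∈F e∉W) (monotone (insert-remove F e∈F)))
      -- Here `e` raises the rank of the flat `H`, and `D` consists of coloops of M|F outside `W`,
      -- so it still adds its full size on top of `H ∪ ⁅ e ⁆`.
      ... | yes e∈W = begin-strict
        r G                         ≡⟨ cong r (∪-─ H⊆G) ⟨
        r (H ∪ D)                   ≤⟨ rank-∪-≤ H D ⟩
        r H + ∣ D ∣                 <⟨ ℕ.+-monoˡ-< ∣ D ∣ (flatH e (e∉G ∘ H⊆G)) ⟩
        r (H ∪ ⁅ e ⁆) + ∣ D ∣       ≡⟨ rank-∪-coloops F D (insert-lub H⊆F (cyc⊆ F e∈W)) (⊆-trans D⊆C C⊆F)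
                                         (C-coloop ∘ D⊆C)
                                         (λ x∈D x∈He → C∉W (D⊆C x∈D) (insert-lub H⊆W e∈W x∈He)) ⟨
        r ((H ∪ ⁅ e ⁆) ∪ D)         ≤⟨ monotone (∪-lub (insert-lub (⊆-trans H⊆G (⊆-insert G e)) (∈-insert G e))
                                         (⊆-trans (p─q⊆p G H) (⊆-insert G e))) ⟩
        r (G ∪ ⁅ e ⁆)               ∎

    -- M|F is the direct sum of M|W and the free matroid on C.
    ∑-flats-cyc : ∀ V (g : ℕ → ℕ) →
                  ∑-flats V F g ≡ ∑-flats V W (λ s → intervalSum (∣ F ∣ ∸ ∣ W ∣) s g)
    ∑-flats-cyc V g = begin
      ∑-flats V F g
        ≡⟨ ∑ˢ-fibres (_∩ W) (powerset n) _ ⟩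
      ∑ˢ (λ H → ∑ˢ (λ G → when (H ≟ G ∩ W) (when (flatIn? V F G) (g (∣ G ∣)))))
        ≡⟨ ∑-cong (powerset n) (λ H → trans (∑-cong (powerset n) (swap H)) (∑-when (flatIn? V W H) (powerset n) _)) ⟩
      ∑ˢ (λ H → when (flatIn? V W H) (∑ˢ (λ G → when (between? H (H ∪ C) G) (g (∣ G ∣)))))
        ≡⟨ ∑-cong (powerset n) (λ H → when-congʳ (flatIn? V W H) λ (_ , H⊆W , _) →
             trans (∑ˢ-between H (H ∪ C) g (p⊆p∪q C))
               (cong (λ d → intervalSum d (∣ H ∣) g)
                 (trans (cong (_∸ ∣ H ∣) (∣∪C∣ H⊆W)) (ℕ.m+n∸m≡n (∣ H ∣) _)))) ⟩
      ∑-flats V W (λ s → intervalSum (∣ F ∣ ∸ ∣ W ∣) s g) ∎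
      where
      open ≡-Reasoning
      swap : ∀ H G → when (H ≟ G ∩ W) (when (flatIn? V F G) (g (∣ G ∣)))
                     ≡ when (flatIn? V W H) (when (between? H (H ∪ C) G) (g (∣ G ∣)))
      swap H G = begin
        when (H ≟ G ∩ W) (when (flatIn? V F G) (g (∣ G ∣)))
          ≡⟨ when-× (H ≟ G ∩ W) (flatIn? V F G) _ ⟨
        when ((H ≟ G ∩ W) ×-dec flatIn? V F G) (g (∣ G ∣))
          ≡⟨ when-cong ((H ≟ G ∩ W) ×-dec flatIn? V F G) (flatIn? V W H ×-dec between? H (H ∪ C) G)
               (λ { (refl , flat) → restrict flat }) (λ (flat , btw) → extend flat btw) (λ _ → refl) ⟩
        when (flatIn? V W H ×-dec between? H (H ∪ C) G) (g (∣ G ∣))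
          ≡⟨ when-× (flatIn? V W H) (between? H (H ∪ C) G) _ ⟩
        when (flatIn? V W H) (when (between? H (H ∪ C) G) (g (∣ G ∣))) ∎

  -- The convolution identity for the sets between a cyclic flat and a flat

  CyclicFlatBetween : Subset n → Subset n → Subset n → Set
  CyclicFlatBetween Y Z W = CyclicFlatSet W × Between Y Z W

  cyclicFlatBetween? : ∀ Y Z W → Dec (CyclicFlatBetween Y Z W)
  cyclicFlatBetween? Y Z W = cyclicFlat? W ×-dec between? Y Z W

  -- The contribution of `W` to the sum over all X: `s` is the size of F = cl X, `t` that of X ∩ W,
  -- and `s ∸ ∣ W ∣` counts the coloops of M|F.
  convolution : Subset n → Subset n → (ℕ → ℕ) → Subset n → ℕ
  convolution Y Z g W = ∑-flats W Z (λ s → ∑-spanning Y W (λ t → g (t + (s ∸ ∣ W ∣))))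

  -- Each X between Y and Z is determined by F = cl X, W = cyc F and X ∩ W,
  -- since X contains the coloops F ─ W of M|F.
  ∑-between-convolution : ∀ {Y Z} (g : ℕ → ℕ) → CyclicFlatSet Y → IsFlat M Z →
    ∑ˢ (λ X → when (between? Y Z X) (g (∣ X ∣))) ≡
    ∑ˢ (λ W → when (cyclicFlatBetween? Y Z W) (convolution Y Z g W))
  ∑-between-convolution {Y} {Z} g cfY flatZ = begin
    ∑ˢ (λ X → when (between? Y Z X) (g (∣ X ∣)))
      ≡⟨ ∑ˢ-fibres cl (powerset n) _ ⟩
    ∑ˢ (λ F → ∑ˢ (λ X → when (F ≟ cl X) (when (between? Y Z X) (g (∣ X ∣)))))
      ≡⟨ ∑ˢ-fibres cyc (powerset n) _ ⟩
    ∑ˢ (λ W → ∑ˢ (λ F → when (W ≟ cyc F) (∑ˢ (λ X → when (F ≟ cl X) (when (between? Y Z X) (g (∣ X ∣)))))))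
      ≡⟨ ∑-cong (powerset n) (λ W → trans (∑-cong (powerset n) (step W))
           (∑-when (cyclicFlatBetween? Y Z W) (powerset n) _)) ⟩
    ∑ˢ (λ W → when (cyclicFlatBetween? Y Z W) (convolution Y Z g W)) ∎
    where
    open ≡-Reasoning
    step : ∀ W F → when (W ≟ cyc F) (∑ˢ (λ X → when (F ≟ cl X) (when (between? Y Z X) (g (∣ X ∣)))))
                   ≡ when (cyclicFlatBetween? Y Z W) (when (flatIn? W Z F)
                       (∑-spanning Y W (λ t → g (t + (∣ F ∣ ∸ ∣ W ∣)))))
    step W F with flatIn? W Z F ×-dec (Y ⊆? W)
    ... | yes ((flatF , F⊆Z , refl) , Y⊆W) = begin
      when (W ≟ W) (∑ˢ (λ X → when (F ≟ cl X) (when (between? Y Z X) (g (∣ X ∣)))))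
        ≡⟨ when-true (W ≟ W) refl ⟩
      ∑ˢ (λ X → when (F ≟ cl X) (when (between? Y Z X) (g (∣ X ∣))))
        ≡⟨ ∑-cong (powerset n) (λ X → when-× (F ≟ cl X) (between? Y Z X) _) ⟨
      ∑ˢ (λ X → when ((F ≟ cl X) ×-dec between? Y Z X) (g (∣ X ∣)))
        ≡⟨ Coloops.∑-closure flatF g Y⊆W F⊆Z ⟩
      ∑-spanning Y W (λ t → g (t + (∣ F ∣ ∸ ∣ W ∣)))
        ≡⟨ when-true (flatIn? W Z F) (flatF , F⊆Z , refl) ⟨
      when (flatIn? W Z F) (∑-spanning Y W (λ t → g (t + (∣ F ∣ ∸ ∣ W ∣))))
        ≡⟨ when-true (cyclicFlatBetween? Y Z W) (cyc-cyclicFlat flatF , Y⊆W , ⊆-trans (cyc⊆ F) F⊆Z) ⟨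
      when (cyclicFlatBetween? Y Z W) (when (flatIn? W Z F)
        (∑-spanning Y W (λ t → g (t + (∣ F ∣ ∸ ∣ W ∣))))) ∎
    -- Both sides vanish: if F = cl X with X between `Y` and `Z`, then F ⊆ Z because `Z` is a flat,
    -- and Y ⊆ cyc F because `Y` is cyclic.
    ... | no ¬flat = begin
      when (W ≟ cyc F) (∑ˢ (λ X → when (F ≟ cl X) (when (between? Y Z X) (g (∣ X ∣)))))
        ≡⟨ ∑-when (W ≟ cyc F) (powerset n) _ ⟨
      ∑ˢ (λ X → when (W ≟ cyc F) (when (F ≟ cl X) (when (between? Y Z X) (g (∣ X ∣)))))
        ≡⟨ ∑-zero (powerset n) (λ X → begin
             when (W ≟ cyc F) (when (F ≟ cl X) (when (between? Y Z X) (g (∣ X ∣))))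
               ≡⟨ cong (when (W ≟ cyc F)) (when-× (F ≟ cl X) (between? Y Z X) _) ⟨
             when (W ≟ cyc F) (when ((F ≟ cl X) ×-dec between? Y Z X) (g (∣ X ∣)))
               ≡⟨ when-× (W ≟ cyc F) ((F ≟ cl X) ×-dec between? Y Z X) _ ⟨
             when ((W ≟ cyc F) ×-dec (F ≟ cl X) ×-dec between? Y Z X) (g (∣ X ∣))
               ≡⟨ when-false ((W ≟ cyc F) ×-dec (F ≟ cl X) ×-dec between? Y Z X)
                    (λ { (refl , refl , Y⊆X , X⊆Z) → ¬flat ((cl-flat X , cl-least flatZ X⊆Z , refl) ,
                           ⊆-cyc cfY (⊆-trans Y⊆X (⊆-cl X))) }) ⟩
             0 ∎) ⟩
      0 ≡⟨ when-false (cyclicFlatBetween? Y Z W ×-dec flatIn? W Z F) (λ ((_ , Y⊆W , _) , flat) → ¬flat (flat , Y⊆W)) ⟨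
      when (cyclicFlatBetween? Y Z W ×-dec flatIn? W Z F) (∑-spanning Y W (λ t → g (t + (∣ F ∣ ∸ ∣ W ∣))))
        ≡⟨ when-× (cyclicFlatBetween? Y Z W) (flatIn? W Z F) _ ⟩
      when (cyclicFlatBetween? Y Z W) (when (flatIn? W Z F)
        (∑-spanning Y W (λ t → g (t + (∣ F ∣ ∸ ∣ W ∣))))) ∎

  -- Separating flats from spanning sets by size

  flatIn-size : ∀ {W Z F} → FlatIn W Z F → r F + ∣ W ∣ ≡ r W + ∣ F ∣
  flatIn-size {F = F} (_ , _ , refl) = rank-size-cyc F

  flatIn-size-≤ : ∀ {W Z F} → FlatIn W Z F → ∣ W ∣ ≤ ∣ F ∣
  flatIn-size-≤ {F = F} (_ , _ , refl) = p⊆q⇒∣p∣≤∣q∣ (cyc⊆ F)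

  -- A flat `F` inside `Z` with the rank of `Z` would be `Z`, and then W = cyc Z = Z. So the rank of
  -- `F` is smaller, and equality of nullities turns this into a bound on its size.
  flatIn-bound : ∀ {W Z F} → CyclicFlatSet Z → W ≢ Z → FlatIn W Z F → r W + ∣ F ∣ < r Z + ∣ W ∣
  flatIn-bound {W} {Z} {F} cfZ@(flatZ , _) W≢Z flat@(flatF , F⊆Z , cycF≡W) = begin-strict
    r W + ∣ F ∣   ≡⟨ flatIn-size flat ⟨
    r F + ∣ W ∣   <⟨ ℕ.+-monoˡ-< ∣ W ∣ (ℕ.≰⇒> λ rZ≤rF →
                       W≢Z (trans (sym cycF≡W) (trans (cong cyc (sym (flat-≡ flatZ flatF F⊆Z rZ≤rF))) (cyc-≡ cfZ)))) ⟩
    r Z + ∣ W ∣   ∎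
    where open ℕ.≤-Reasoning

  -- Each element beyond `Y` adds at most 1 to the rank, and the rank of `Z` has to be reached.
  spanning-bound : ∀ {Y Z X} → Spanning Y Z X → r Z + ∣ Y ∣ ≤ r Y + ∣ X ∣
  spanning-bound {Y} {Z} {X} ((Y⊆X , _) , spans) = begin
    r Z + ∣ Y ∣                    ≤⟨ ℕ.+-monoˡ-≤ ∣ Y ∣ (ℕ.≤-trans spans (ℕ.≤-trans
                                        (ℕ.≤-reflexive (cong r (sym (∪-─ Y⊆X)))) (rank-∪-≤ Y (X ─ Y)))) ⟩
    r Y + ∣ X ─ Y ∣ + ∣ Y ∣        ≡⟨ ℕ.+-assoc (r Y) _ _ ⟩
    r Y + (∣ X ─ Y ∣ + ∣ Y ∣)      ≡⟨ cong (r Y +_) (trans (ℕ.+-comm (∣ X ─ Y ∣) _) (sym (∣─∣ Y⊆X))) ⟩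
    r Y + ∣ X ∣                    ∎
    where open ℕ.≤-Reasoning

  ∑-flats-self : ∀ {Z} (g : ℕ → ℕ) → CyclicFlatSet Z → ∑-flats Z Z g ≡ g (∣ Z ∣)
  ∑-flats-self {Z} g cfZ@(flatZ , _) = trans
    (∑-cong (powerset n) λ F → when-cong (flatIn? Z Z F) (F ≟ Z)
      (λ (_ , F⊆Z , cycF≡Z) → ⊆-antisym F⊆Z (subst (_⊆ F) cycF≡Z (cyc⊆ F)))
      (λ { refl → flatZ , ⊆-refl , cyc-≡ cfZ }) (λ _ → refl))
    (∑ˢ-point Z (λ F → g (∣ F ∣)))

  ∑-spanning-self : ∀ Z (g : ℕ → ℕ) → ∑-spanning Z Z g ≡ g (∣ Z ∣)
  ∑-spanning-self Z g = trans
    (∑-cong (powerset n) λ X → when-cong (spanning? Z Z X) (X ≟ Z)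
      (λ ((Z⊆X , X⊆Z) , _) → ⊆-antisym X⊆Z Z⊆X)
      (λ { refl → (⊆-refl , ⊆-refl) , ℕ.≤-refl }) (λ _ → refl))
    (∑ˢ-point Z (λ X → g (∣ X ∣)))

  ∑-flats-cong : ∀ W Z {g h : ℕ → ℕ} → (∀ s → g s ≡ h s) → ∑-flats W Z g ≡ ∑-flats W Z h
  ∑-flats-cong W Z eq = ∑-cong (powerset n) λ F → cong (when (flatIn? W Z F)) (eq (∣ F ∣))

  -- At the end W = Y the only spanning set is `Y` itself, and at W = Z the only flat is `Z`; so the
  -- two extreme terms of the convolution are the unknown sums themselves.
  convolution-bottom : ∀ {Y Z} (g : ℕ → ℕ) → CyclicFlatSet Y → convolution Y Z g Y ≡ ∑-flats Y Z g
  convolution-bottom {Y} {Z} g cfY = ∑-cong (powerset n) λ F → when-congʳ (flatIn? Y Z F) λ flat →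
    trans (∑-spanning-self Y (λ t → g (t + (∣ F ∣ ∸ ∣ Y ∣)))) (cong g (ℕ.m+[n∸m]≡n (flatIn-size-≤ flat)))

  convolution-top : ∀ {Y Z} (g : ℕ → ℕ) → CyclicFlatSet Z → convolution Y Z g Z ≡ ∑-spanning Y Z g
  convolution-top {Y} {Z} g cfZ = trans (∑-flats-self (λ s → ∑-spanning Y Z (λ t → g (t + (s ∸ ∣ Z ∣)))) cfZ)
    (∑-cong (powerset n) λ X → cong (when (spanning? Y Z X) ∘ g)
      (trans (cong (∣ X ∣ +_) (ℕ.n∸n≡0 (∣ Z ∣))) (ℕ.+-identityʳ (∣ X ∣))))

  below? : ∀ Y Z s → Dec (r Y + s < r Z + ∣ Y ∣)
  below? Y Z s = (r Y + s) ℕ.<? (r Z + ∣ Y ∣)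

  -- The threshold r Z + ∣ Y ∣ separates the sizes of the flats from those of the spanning sets.
  ∑-below : ∀ {Y Z} (g : ℕ → ℕ) → CyclicFlatSet Z → Y ≢ Z → let h = λ s → when (below? Y Z s) (g s) in
            ∑-flats Y Z h + ∑-spanning Y Z h ≡ ∑-flats Y Z g
  ∑-below {Y} {Z} g cfZ Y≢Z = trans
    (cong₂ _+_
      (∑-cong (powerset n) λ F → when-congʳ (flatIn? Y Z F) λ flat →
        when-true (below? Y Z (∣ F ∣)) (flatIn-bound cfZ Y≢Z flat))
      (∑-zero (powerset n) λ X → trans (when-congʳ (spanning? Y Z X) λ sp →
        when-false (below? Y Z (∣ X ∣)) (ℕ.≤⇒≯ (spanning-bound sp))) (when-0 (spanning? Y Z X))))
    (ℕ.+-identityʳ _)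

  ∑-above : ∀ {Y Z} (g : ℕ → ℕ) → CyclicFlatSet Z → Y ≢ Z → let h = λ s → when (¬? (below? Y Z s)) (g s) in
            ∑-flats Y Z h + ∑-spanning Y Z h ≡ ∑-spanning Y Z g
  ∑-above {Y} {Z} g cfZ Y≢Z = cong₂ _+_
    (∑-zero (powerset n) λ F → trans (when-congʳ (flatIn? Y Z F) λ flat →
      when-false (¬? (below? Y Z (∣ F ∣))) (λ ¬below → ¬below (flatIn-bound cfZ Y≢Z flat))) (when-0 (flatIn? Y Z F)))
    (∑-cong (powerset n) λ X → when-congʳ (spanning? Y Z X) λ sp →
      when-true (¬? (below? Y Z (∣ X ∣))) (ℕ.≤⇒≯ (spanning-bound sp)))

  -- Covers of flats and weights carried along them

  Cover : Subset n → Subset n → Set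
  Cover G F = IsFlat M G × IsFlat M F × G ⊆ F × suc (r G) ≡ r F

  cover? : ∀ G F → Dec (Cover G F)
  cover? G F = isFlat? M G ×-dec isFlat? M F ×-dec (G ⊆? F) ×-dec (suc (r G) ℕ.≟ r F)

  -- `∑-flats` sees a flat only through its size, so the rank condition on a lower cover is restated
  -- as a condition on ∣G∣; equality of nullities makes the two equivalent over a fixed `W`.
  LowerCoverOver : Subset n → Subset n → Subset n → Set
  LowerCoverOver W F G = FlatIn W F G × r W + suc ∣ G ∣ ≡ r F + ∣ W ∣

  lowerCoverOver? : ∀ W F G → Dec (LowerCoverOver W F G)
  lowerCoverOver? W F G = flatIn? W F G ×-dec ((r W + suc ∣ G ∣) ℕ.≟ (r F + ∣ W ∣))

  lowerCoverOver-rank : ∀ {W F G} → LowerCoverOver W F G → suc (r G) ≡ r F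
  lowerCoverOver-rank {W} {F} {G} (flat , size) = ℕ.+-cancelʳ-≡ ∣ W ∣ _ _
    (trans (cong suc (flatIn-size flat)) (trans (sym (ℕ.+-suc (r W) ∣ G ∣)) size))

  cover⇒lowerCoverOver : ∀ {G F} → Cover G F → LowerCoverOver (cyc G) F G
  cover⇒lowerCoverOver {G} {F} (flatG , _ , G⊆F , rank) = (flatG , G⊆F , refl) ,
    trans (ℕ.+-suc (r (cyc G)) ∣ G ∣) (trans (cong suc (sym (rank-size-cyc G))) (cong (_+ ∣ cyc G ∣) rank))

  -- The lower covers are grouped by cyclic part, since within one group they all have the same
  -- cyclic part and the same rank.
  ∑-lowerCovers : ∀ {F} (u : Subset n → ℕ) → IsFlat M F →
    ∑ˢ (λ G → when (cover? G F) (u G)) ≡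
    ∑ˢ (λ W → when (cyclicFlatBetween? ⊥ (cyc F) W) (∑ˢ (λ G → when (lowerCoverOver? W F G) (u G))))
  ∑-lowerCovers {F} u flatF = begin
    ∑ˢ (λ G → when (cover? G F) (u G))
      ≡⟨ ∑ˢ-fibres cyc (powerset n) _ ⟩
    ∑ˢ (λ W → ∑ˢ (λ G → when (W ≟ cyc G) (when (cover? G F) (u G))))
      ≡⟨ ∑-cong (powerset n) (λ W → trans (∑-cong (powerset n) (step W))
           (∑-when (cyclicFlatBetween? ⊥ (cyc F) W) (powerset n) _)) ⟩
    ∑ˢ (λ W → when (cyclicFlatBetween? ⊥ (cyc F) W) (∑ˢ (λ G → when (lowerCoverOver? W F G) (u G)))) ∎
    where
    open ≡-Reasoning
    step : ∀ W G → when (W ≟ cyc G) (when (cover? G F) (u G))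
                   ≡ when (cyclicFlatBetween? ⊥ (cyc F) W) (when (lowerCoverOver? W F G) (u G))
    step W G = begin
      when (W ≟ cyc G) (when (cover? G F) (u G))
        ≡⟨ when-× (W ≟ cyc G) (cover? G F) _ ⟨
      when ((W ≟ cyc G) ×-dec cover? G F) (u G)
        ≡⟨ when-cong ((W ≟ cyc G) ×-dec cover? G F) (cyclicFlatBetween? ⊥ (cyc F) W ×-dec lowerCoverOver? W F G)
             (λ { (refl , cov@(flatG , _ , G⊆F , _)) →
                    (cyc-cyclicFlat flatG , ⊥⊆ , cyc-mono G⊆F) , cover⇒lowerCoverOver cov })
             (λ { (_ , low@((flatG , G⊆F , refl) , _)) → refl , flatG , flatF , G⊆F , lowerCoverOver-rank low })
             (λ _ → refl) ⟩
      when (cyclicFlatBetween? ⊥ (cyc F) W ×-dec lowerCoverOver? W F G) (u G)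
        ≡⟨ when-× (cyclicFlatBetween? ⊥ (cyc F) W) (lowerCoverOver? W F G) _ ⟩
      when (cyclicFlatBetween? ⊥ (cyc F) W) (when (lowerCoverOver? W F G) (u G)) ∎

  upperSum : (ℕ → ℕ → ℕ) → (Subset n → ℕ) → Subset n → ℕ
  upperSum w V F = ∑ˢ (λ G → when (cover? F G) (w (∣ F ∣) (∣ G ∣) * V G))

  lowerSum : (ℕ → ℕ → ℕ) → (Subset n → ℕ) → Subset n → ℕ
  lowerSum w u G = ∑ˢ (λ F → when (cover? F G) (u F * w (∣ F ∣) (∣ G ∣)))

  pairing : (Subset n → ℕ) → (Subset n → ℕ) → ℕ
  pairing u V = ∑ˢ (λ F → when (isFlat? M F) (u F * V F))

  -- Both sides are one double sum over the covers of G over F; it is read from below on the left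
  -- and from above on the right.
  pairing-adjoint : ∀ w u V → pairing u (upperSum w V) ≡ pairing (lowerSum w u) V
  pairing-adjoint w u V = begin
    ∑ˢ (λ F → when (isFlat? M F) (u F * upperSum w V F))
      ≡⟨ ∑-cong (powerset n) left ⟩
    ∑ˢ (λ F → ∑ˢ (λ G → when (cover? F G) (u F * w (∣ F ∣) (∣ G ∣) * V G)))
      ≡⟨ ∑-swap (powerset n) (powerset n) _ ⟩
    ∑ˢ (λ G → ∑ˢ (λ F → when (cover? F G) (u F * w (∣ F ∣) (∣ G ∣) * V G)))
      ≡⟨ ∑-cong (powerset n) right ⟨
    ∑ˢ (λ G → when (isFlat? M G) (lowerSum w u G * V G)) ∎
    where
    open ≡-Reasoning
    left : ∀ F → when (isFlat? M F) (u F * upperSum w V F)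
                 ≡ ∑ˢ (λ G → when (cover? F G) (u F * w (∣ F ∣) (∣ G ∣) * V G))
    left F = begin
      when (isFlat? M F) (u F * upperSum w V F)
        ≡⟨ cong (when (isFlat? M F)) (∑-*ˡ (powerset n) (u F) _) ⟨
      when (isFlat? M F) (∑ˢ (λ G → u F * when (cover? F G) (w (∣ F ∣) (∣ G ∣) * V G)))
        ≡⟨ ∑-when (isFlat? M F) (powerset n) _ ⟨
      ∑ˢ (λ G → when (isFlat? M F) (u F * when (cover? F G) (w (∣ F ∣) (∣ G ∣) * V G)))
        ≡⟨ ∑-cong (powerset n) (λ G → begin
             when (isFlat? M F) (u F * when (cover? F G) (w (∣ F ∣) (∣ G ∣) * V G))
               ≡⟨ cong (when (isFlat? M F)) (when-*ʳ (cover? F G) (u F) _) ⟨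
             when (isFlat? M F) (when (cover? F G) (u F * (w (∣ F ∣) (∣ G ∣) * V G)))
               ≡⟨ when-× (isFlat? M F) (cover? F G) _ ⟨
             when (isFlat? M F ×-dec cover? F G) (u F * (w (∣ F ∣) (∣ G ∣) * V G))
               ≡⟨ when-cong (isFlat? M F ×-dec cover? F G) (cover? F G) proj₂ (λ cov → proj₁ cov , cov)
                    (λ _ → sym (ℕ.*-assoc (u F) _ _)) ⟩
             when (cover? F G) (u F * w (∣ F ∣) (∣ G ∣) * V G) ∎) ⟩
      ∑ˢ (λ G → when (cover? F G) (u F * w (∣ F ∣) (∣ G ∣) * V G)) ∎
    right : ∀ G → when (isFlat? M G) (lowerSum w u G * V G)
                  ≡ ∑ˢ (λ F → when (cover? F G) (u F * w (∣ F ∣) (∣ G ∣) * V G))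
    right G = begin
      when (isFlat? M G) (lowerSum w u G * V G)
        ≡⟨ cong (when (isFlat? M G)) (∑-*ʳ (powerset n) _ (V G)) ⟨
      when (isFlat? M G) (∑ˢ (λ F → when (cover? F G) (u F * w (∣ F ∣) (∣ G ∣)) * V G))
        ≡⟨ ∑-when (isFlat? M G) (powerset n) _ ⟨
      ∑ˢ (λ F → when (isFlat? M G) (when (cover? F G) (u F * w (∣ F ∣) (∣ G ∣)) * V G))
        ≡⟨ ∑-cong (powerset n) (λ F → begin
             when (isFlat? M G) (when (cover? F G) (u F * w (∣ F ∣) (∣ G ∣)) * V G)
               ≡⟨ cong (when (isFlat? M G)) (when-*ˡ (cover? F G) _ (V G)) ⟨
             when (isFlat? M G) (when (cover? F G) (u F * w (∣ F ∣) (∣ G ∣) * V G))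
               ≡⟨ when-× (isFlat? M G) (cover? F G) _ ⟨
             when (isFlat? M G ×-dec cover? F G) (u F * w (∣ F ∣) (∣ G ∣) * V G)
               ≡⟨ when-cong (isFlat? M G ×-dec cover? F G) (cover? F G) proj₂
                    (λ cov → proj₁ (proj₂ cov) , cov) (λ _ → refl) ⟩
             when (cover? F G) (u F * w (∣ F ∣) (∣ G ∣) * V G) ∎) ⟩
      ∑ˢ (λ F → when (cover? F G) (u F * w (∣ F ∣) (∣ G ∣) * V G)) ∎

-- Splitting and comparing sums

∑ˢ-split₂ : {Y Z : Subset n} (f : Subset n → ℕ) → Y ≢ Z →
            ∑ˢ f ≡ (f Y + f Z) + ∑ˢ (λ W → when (¬? (W ≟ Y) ×-dec ¬? (W ≟ Z)) (f W))
∑ˢ-split₂ {n = n} {Y} {Z} f Y≢Z = begin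
  ∑ˢ f
    ≡⟨ ∑-cong (powerset n) split ⟩
  ∑ˢ (λ W → (when (W ≟ Y) (f W) + when (W ≟ Z) (f W)) + rest W)
    ≡⟨ ∑-+ (powerset n) _ rest ⟩
  ∑ˢ (λ W → when (W ≟ Y) (f W) + when (W ≟ Z) (f W)) + ∑ˢ rest
    ≡⟨ cong (_+ ∑ˢ rest) (∑-+ (powerset n) _ _) ⟩
  (∑ˢ (λ W → when (W ≟ Y) (f W)) + ∑ˢ (λ W → when (W ≟ Z) (f W))) + ∑ˢ rest
    ≡⟨ cong (_+ ∑ˢ rest) (cong₂ _+_ (∑ˢ-point Y f) (∑ˢ-point Z f)) ⟩
  (f Y + f Z) + ∑ˢ rest ∎
  where
  open ≡-Reasoning
  rest : Subset n → ℕ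
  rest W = when (¬? (W ≟ Y) ×-dec ¬? (W ≟ Z)) (f W)
  split : ∀ W → f W ≡ (when (W ≟ Y) (f W) + when (W ≟ Z) (f W)) + rest W
  split W with W ≟ Y | W ≟ Z
  ... | yes refl | yes refl = contradiction refl Y≢Z
  ... | yes _    | no _     = sym (trans (ℕ.+-identityʳ _) (ℕ.+-identityʳ _))
  ... | no _     | yes _    = sym (ℕ.+-identityʳ _)
  ... | no _     | no _     = refl

∑-filter : {P : A → Set p} (P? : ∀ x → Dec (P x)) (xs : List A) (u : A → ℕ) →
           ∑ xs (λ x → when (P? x) (u x)) ≡ ∑ (filter P? xs) u
∑-filter P? []       u = refl
∑-filter P? (x ∷ xs) u with does (P? x)
... | true  = cong (u x +_) (∑-filter P? xs u)
... | false = ∑-filter P? xs u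

∑-constant : {P : A → Set p} {Q : B → Set q} {xs : List A} {ys : List B} {u : A → ℕ} {v : B → ℕ} →
             (∀ x y → P x → Q y → u x ≡ v y) → ListAll.All P xs → ListAll.All Q ys →
             length xs ≡ length ys → ∑ xs u ≡ ∑ ys v
∑-constant eq []         []         _   = refl
∑-constant eq (px ∷ pxs) (qy ∷ qys) len =
  cong₂ _+_ (eq _ _ px qy) (∑-constant eq pxs qys (ℕ.suc-injective len))

-- Every `x` in `P` is related to every `y` in `Q`, so the two filtered lists can be paired off in
-- whatever order they come; equal lengths suffice and no bijection has to be named.
∑-when-constant : {P : A → Set p} {Q : B → Set q} (P? : ∀ x → Dec (P x)) (Q? : ∀ y → Dec (Q y))
                  (xs : List A) (ys : List B) {u : A → ℕ} {v : B → ℕ} →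
                  (∀ x y → P x → Q y → u x ≡ v y) →
                  ∑ xs (λ x → when (P? x) 1) ≡ ∑ ys (λ y → when (Q? y) 1) →
                  ∑ xs (λ x → when (P? x) (u x)) ≡ ∑ ys (λ y → when (Q? y) (v y))
∑-when-constant P? Q? xs ys {u} {v} eq count = begin
  ∑ xs (λ x → when (P? x) (u x)) ≡⟨ ∑-filter P? xs u ⟩
  ∑ (filter P? xs) u             ≡⟨ ∑-constant eq (all-filter P? xs) (all-filter Q? ys)
                                      (trans (length-filter-∑ P? xs) (trans count (sym (length-filter-∑ Q? ys)))) ⟩
  ∑ (filter Q? ys) v             ≡⟨ ∑-filter Q? ys v ⟨
  ∑ ys (λ y → when (Q? y) (v y)) ∎
  where open ≡-Reasoning

-- Matroids with the same configuration

module Comparison {n n′} (M : Matroid n) (M′ : Matroid n′)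
                  (iso : configuration M ≅ configuration M′) where

  open _≅_ iso
  open IsOrderIsomorphism isOrderIsomorphism using (mono; injective; surjective) renaming (cong to φ-cong)

  private
    module T  = MatroidTheory M
    module T′ = MatroidTheory M′
    r  = rank M
    r′ = rank M′

  cyclicFlat : ∀ {Z} → T.CyclicFlatSet Z → CyclicFlat M
  cyclicFlat {Z} (flat , Z⊆) = Z , flat , T.⊆cyc⇒cyclic Z⊆

  cyclicFlat′ : ∀ {Z} → T′.CyclicFlatSet Z → CyclicFlat M′
  cyclicFlat′ {Z} (flat , Z⊆) = Z , flat , T′.⊆cyc⇒cyclic Z⊆

  -- φ and its inverse extended to all subsets, with junk value ⊥ off the cyclic flats.
  Φ : Subset n → Subset n′
  Φ Z with T.cyclicFlat? Z
  ... | yes cf = proj₁ (φ (cyclicFlat cf))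
  ... | no  _  = ⊥

  Ψ : Subset n′ → Subset n
  Ψ Z with T′.cyclicFlat? Z
  ... | yes cf = proj₁ (proj₁ (surjective (cyclicFlat′ cf)))
  ... | no  _  = ⊥

  -- The proofs stored in `x` may differ from those that `cyclicFlat?` yields, but `φ` respects
  -- equality in 𝒵, which compares underlying sets.
  Φ-φ : (x : CyclicFlat M) → Φ (proj₁ x) ≡ proj₁ (φ x)
  Φ-φ x@(Z , flat , cyclic) with T.cyclicFlat? Z
  ... | yes cf = φ-cong {x = cyclicFlat cf} {y = x} refl
  ... | no ¬cf = ⊥-elim (¬cf (flat , T.cyclic⇒⊆cyc cyclic))

  Φ-cyclicFlat : ∀ {Z} → T.CyclicFlatSet Z → T′.CyclicFlatSet (Φ Z)
  Φ-cyclicFlat cf = subst T′.CyclicFlatSet (sym (Φ-φ (cyclicFlat cf)))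
    (let (_ , flat , cyclic) = φ (cyclicFlat cf) in flat , T′.cyclic⇒⊆cyc cyclic)

  Ψ-spec : ∀ {Z} → T′.CyclicFlatSet Z → T.CyclicFlatSet (Ψ Z) × Φ (Ψ Z) ≡ Z
  Ψ-spec {Z} cf with T′.cyclicFlat? Z
  ... | no ¬cf = ⊥-elim (¬cf cf)
  ... | yes cf′ =
    let (x , φx≈) = surjective (cyclicFlat′ cf′)
        (_ , flat , cyclic) = x
    in (flat , T.cyclic⇒⊆cyc cyclic) , trans (Φ-φ x) (φx≈ {x} refl)

  ΦΨ : ∀ {Z} → T′.CyclicFlatSet Z → Φ (Ψ Z) ≡ Z
  ΦΨ cf = proj₂ (Ψ-spec cf)

  Ψ-cyclicFlat : ∀ {Z} → T′.CyclicFlatSet Z → T.CyclicFlatSet (Ψ Z)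
  Ψ-cyclicFlat cf = proj₁ (Ψ-spec cf)

  Φ-injective : ∀ {Y Z} → T.CyclicFlatSet Y → T.CyclicFlatSet Z → Φ Y ≡ Φ Z → Y ≡ Z
  Φ-injective cfY cfZ eq = injective {cyclicFlat cfY} {cyclicFlat cfZ}
    (trans (sym (Φ-φ (cyclicFlat cfY))) (trans eq (Φ-φ (cyclicFlat cfZ))))

  ΨΦ : ∀ {Z} → T.CyclicFlatSet Z → Ψ (Φ Z) ≡ Z
  ΨΦ cf = let cf′ = Φ-cyclicFlat cf in Φ-injective (Ψ-cyclicFlat cf′) cf (ΦΨ cf′)

  Φ-mono : ∀ {Y Z} → T.CyclicFlatSet Y → T.CyclicFlatSet Z → Y ⊆ Z → Φ Y ⊆ Φ Z
  Φ-mono cfY cfZ Y⊆Z = subst₂ _⊆_ (sym (Φ-φ (cyclicFlat cfY))) (sym (Φ-φ (cyclicFlat cfZ)))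
    (mono {cyclicFlat cfY} {cyclicFlat cfZ} Y⊆Z)

  Φ-cancel : ∀ {Y Z} → T.CyclicFlatSet Y → T.CyclicFlatSet Z → Φ Y ⊆ Φ Z → Y ⊆ Z
  Φ-cancel cfY cfZ ΦY⊆ΦZ = cancel {cyclicFlat cfY} {cyclicFlat cfZ}
    (subst₂ _⊆_ (Φ-φ (cyclicFlat cfY)) (Φ-φ (cyclicFlat cfZ)) ΦY⊆ΦZ)
    where open IsOrderIsomorphism isOrderIsomorphism using (cancel)

  Φ-size : ∀ {Z} → T.CyclicFlatSet Z → ∣ Φ Z ∣ ≡ ∣ Z ∣
  Φ-size cf = trans (cong ∣_∣ (Φ-φ (cyclicFlat cf))) (s-preserved (cyclicFlat cf))

  Φ-rank : ∀ {Z} → T.CyclicFlatSet Z → r′ (Φ Z) ≡ r Z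
  Φ-rank cf = trans (cong r′ (Φ-φ (cyclicFlat cf))) (ρ-preserved (cyclicFlat cf))

  -- Induction on intervals of cyclic flats

  record EqualCounts (Y Z : Subset n) : Set where
    field
      flats    : ∀ g → T.∑-flats Y Z g ≡ T′.∑-flats (Φ Y) (Φ Z) g
      spanning : ∀ g → T.∑-spanning Y Z g ≡ T′.∑-spanning (Φ Y) (Φ Z) g

  open EqualCounts

  equalCounts-self : ∀ {Z} → T.CyclicFlatSet Z → EqualCounts Z Z
  equalCounts-self {Z} cf = record
    { flats    = λ g → trans (T.∑-flats-self g cf)
        (trans (cong g (sym (Φ-size cf))) (sym (T′.∑-flats-self g (Φ-cyclicFlat cf))))
    ; spanning = λ g → trans (T.∑-spanning-self Z g)
        (trans (cong g (sym (Φ-size cf))) (sym (T′.∑-spanning-self (Φ Z) g)))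
    }

  convolution-Φ : ∀ {Y Z W} g → T.CyclicFlatSet W → EqualCounts W Z → EqualCounts Y W →
                  T.convolution Y Z g W ≡ T′.convolution (Φ Y) (Φ Z) g (Φ W)
  convolution-Φ {Y} {Z} {W} g cfW upper lower = trans
    (T.∑-flats-cong W Z λ s → trans (spanning lower (λ t → g (t + (s ∸ ∣ W ∣))))
      (∑-cong (powerset n′) λ X → cong (λ k → when (T′.spanning? (Φ Y) (Φ W) X) (g (∣ X ∣ + (s ∸ k))))
        (sym (Φ-size cfW))))
    (flats upper (λ s → T′.∑-spanning (Φ Y) (Φ W) (λ t → g (t + (s ∸ ∣ Φ W ∣)))))

  module _ {Y Z} (cfY : T.CyclicFlatSet Y) (cfZ : T.CyclicFlatSet Z) (Y⊆Z : Y ⊆ Z) (Y≢Z : Y ≢ Z)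
           (upper : ∀ {W} → T.CyclicFlatSet W → Y ⊆ W → W ⊆ Z → W ≢ Y → EqualCounts W Z)
           (lower : ∀ {W} → T.CyclicFlatSet W → Y ⊆ W → W ⊆ Z → W ≢ Z → EqualCounts Y W) where

    private
      cfY′ = Φ-cyclicFlat cfY
      cfZ′ = Φ-cyclicFlat cfZ

    -- The convolutions have equal totals because `Φ` keeps the sizes of both ends. The terms
    -- strictly between agree by `upper` and `lower` and cancel, which leaves the two extreme terms
    -- together.
    total-Φ : ∀ g → T.∑-flats Y Z g + T.∑-spanning Y Z g
                    ≡ T′.∑-flats (Φ Y) (Φ Z) g + T′.∑-spanning (Φ Y) (Φ Z) g
    total-Φ g = begin
      T.∑-flats Y Z g + T.∑-spanning Y Z g
        ≡⟨ cong₂ _+_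
            (trans (when-true (cfb? Y) (cfY , ⊆-refl {x = Y} , Y⊆Z)) (T.convolution-bottom {Y} {Z} g cfY))
            (trans (when-true (cfb? Z) (cfZ , Y⊆Z , ⊆-refl {x = Z})) (T.convolution-top {Y} {Z} g cfZ)) ⟨
      f Y + f Z
        ≡⟨ ℕ.+-cancelʳ-≡ (∑ˢ (rest f)) _ _ (begin
             (f Y + f Z) + ∑ˢ (rest f)      ≡⟨ ∑ˢ-split₂ f Y≢Z ⟨
             ∑ˢ f                           ≡⟨ sums ⟩
             ∑ˢ f′                          ≡⟨ ∑ˢ-split₂ f′ Y≢Z ⟩
             (f′ Y + f′ Z) + ∑ˢ (rest f′)   ≡⟨ cong (f′ Y + f′ Z +_) (∑-cong (powerset n) rests) ⟨
             (f′ Y + f′ Z) + ∑ˢ (rest f)    ∎) ⟩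
      f′ Y + f′ Z
        ≡⟨ cong₂ _+_
            (trans (when-true (cfb? Y) (cfY , ⊆-refl {x = Y} , Y⊆Z)) (T′.convolution-bottom {Φ Y} {Φ Z} g cfY′))
            (trans (when-true (cfb? Z) (cfZ , Y⊆Z , ⊆-refl {x = Z})) (T′.convolution-top {Φ Y} {Φ Z} g cfZ′)) ⟩
      T′.∑-flats (Φ Y) (Φ Z) g + T′.∑-spanning (Φ Y) (Φ Z) g ∎
      where
      open ≡-Reasoning
      cfb? = T.cyclicFlatBetween? Y Z
      f f′ : Subset n → ℕ
      f  W = when (cfb? W) (T.convolution Y Z g W)
      -- The terms of `M′` are pulled back along `Φ`, so that both sums run over the same subsets
      -- and can be split at the same `Y` and `Z`.
      f′ W = when (cfb? W) (T′.convolution (Φ Y) (Φ Z) g (Φ W))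
      rest : (Subset n → ℕ) → Subset n → ℕ
      rest h W = when (¬? (W ≟ Y) ×-dec ¬? (W ≟ Z)) (h W)
      rests : ∀ W → rest f W ≡ rest f′ W
      rests W = when-congʳ (¬? (W ≟ Y) ×-dec ¬? (W ≟ Z)) λ (W≢Y , W≢Z) →
        when-congʳ (cfb? W) λ (cfW , Y⊆W , W⊆Z) →
          convolution-Φ g cfW (upper cfW Y⊆W W⊆Z W≢Y) (lower cfW Y⊆W W⊆Z W≢Z)
      sums : ∑ˢ f ≡ ∑ˢ f′
      sums = begin
        ∑ˢ f
          ≡⟨ T.∑-between-convolution g cfY (proj₁ cfZ) ⟨
        ∑ˢ (λ X → when (between? Y Z X) (g (∣ X ∣)))
          ≡⟨ ∑ˢ-between Y Z g Y⊆Z ⟩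
        intervalSum (∣ Z ∣ ∸ ∣ Y ∣) (∣ Y ∣) g
          ≡⟨ cong₂ (λ z y → intervalSum (z ∸ y) y g) (Φ-size cfZ) (Φ-size cfY) ⟨
        intervalSum (∣ Φ Z ∣ ∸ ∣ Φ Y ∣) (∣ Φ Y ∣) g
          ≡⟨ ∑ˢ-between (Φ Y) (Φ Z) g (Φ-mono cfY cfZ Y⊆Z) ⟨
        ∑ˢ (λ X → when (between? (Φ Y) (Φ Z) X) (g (∣ X ∣)))
          ≡⟨ T′.∑-between-convolution g cfY′ (proj₁ cfZ′) ⟩
        ∑ˢ (λ W → when (T′.cyclicFlatBetween? (Φ Y) (Φ Z) W) (T′.convolution (Φ Y) (Φ Z) g W))
          ≡⟨ ∑ˢ-reindex cfb? (T′.cyclicFlatBetween? (Φ Y) (Φ Z)) Φ Ψ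
               (λ W → T′.convolution (Φ Y) (Φ Z) g (Φ W)) (T′.convolution (Φ Y) (Φ Z) g)
               (λ W (cfW , Y⊆W , W⊆Z) →
                  (Φ-cyclicFlat cfW , Φ-mono cfY cfW Y⊆W , Φ-mono cfW cfZ W⊆Z) , ΨΦ cfW , refl)
               (λ W (cfW , Y⊆W , W⊆Z) →
                  (Ψ-cyclicFlat cfW ,
                   Φ-cancel cfY (Ψ-cyclicFlat cfW) (subst (Φ Y ⊆_) (sym (ΦΨ cfW)) Y⊆W) ,
                   Φ-cancel (Ψ-cyclicFlat cfW) cfZ (subst (_⊆ Φ Z) (sym (ΦΨ cfW)) W⊆Z)) , ΦΨ cfW) ⟨
        ∑ˢ f′ ∎

    -- `total-Φ` holds for every test function, hence for `g` cut off at either side of the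
    -- threshold, where one of the two sums disappears. `Φ` keeps the ranks and sizes that define
    -- the threshold.
    equalCounts-step : EqualCounts Y Z
    equalCounts-step = record
      { flats    = λ g → begin
          T.∑-flats Y Z g
            ≡⟨ T.∑-below g cfZ Y≢Z ⟨
          T.∑-flats Y Z (below g) + T.∑-spanning Y Z (below g)
            ≡⟨ total-Φ (below g) ⟩
          T′.∑-flats (Φ Y) (Φ Z) (below g) + T′.∑-spanning (Φ Y) (Φ Z) (below g)
            ≡⟨ cong₂ _+_
                (T′.∑-flats-cong (Φ Y) (Φ Z) (below-Φ g))
                (∑-cong (powerset n′) λ X → cong (when (T′.spanning? (Φ Y) (Φ Z) X)) (below-Φ g (∣ X ∣))) ⟩
          T′.∑-flats (Φ Y) (Φ Z) (below′ g) + T′.∑-spanning (Φ Y) (Φ Z) (below′ g)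
            ≡⟨ T′.∑-below g cfZ′ ΦY≢ΦZ ⟩
          T′.∑-flats (Φ Y) (Φ Z) g ∎
      ; spanning = λ g → begin
          T.∑-spanning Y Z g
            ≡⟨ T.∑-above g cfZ Y≢Z ⟨
          T.∑-flats Y Z (above g) + T.∑-spanning Y Z (above g)
            ≡⟨ total-Φ (above g) ⟩
          T′.∑-flats (Φ Y) (Φ Z) (above g) + T′.∑-spanning (Φ Y) (Φ Z) (above g)
            ≡⟨ cong₂ _+_
                (T′.∑-flats-cong (Φ Y) (Φ Z) (above-Φ g))
                (∑-cong (powerset n′) λ X → cong (when (T′.spanning? (Φ Y) (Φ Z) X)) (above-Φ g (∣ X ∣))) ⟩
          T′.∑-flats (Φ Y) (Φ Z) (above′ g) + T′.∑-spanning (Φ Y) (Φ Z) (above′ g)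
            ≡⟨ T′.∑-above g cfZ′ ΦY≢ΦZ ⟩
          T′.∑-spanning (Φ Y) (Φ Z) g ∎
      }
      where
      open ≡-Reasoning
      ΦY≢ΦZ : Φ Y ≢ Φ Z
      ΦY≢ΦZ = Y≢Z ∘ Φ-injective cfY cfZ
      below below′ above above′ : (ℕ → ℕ) → ℕ → ℕ
      below  g s = when (T.below? Y Z s) (g s)
      below′ g s = when (T′.below? (Φ Y) (Φ Z) s) (g s)
      above  g s = when (¬? (T.below? Y Z s)) (g s)
      above′ g s = when (¬? (T′.below? (Φ Y) (Φ Z) s)) (g s)
      to : ∀ {s} → r Y + s < r Z + ∣ Y ∣ → r′ (Φ Y) + s < r′ (Φ Z) + ∣ Φ Y ∣
      to {s} = subst₂ _<_ (cong (_+ s) (sym (Φ-rank cfY))) (cong₂ _+_ (sym (Φ-rank cfZ)) (sym (Φ-size cfY)))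
      from : ∀ {s} → r′ (Φ Y) + s < r′ (Φ Z) + ∣ Φ Y ∣ → r Y + s < r Z + ∣ Y ∣
      from {s} = subst₂ _<_ (cong (_+ s) (Φ-rank cfY)) (cong₂ _+_ (Φ-rank cfZ) (Φ-size cfY))
      below-Φ : ∀ g s → below g s ≡ below′ g s
      below-Φ g s = when-cong (T.below? Y Z s) (T′.below? (Φ Y) (Φ Z) s) to from (λ _ → refl)
      above-Φ : ∀ g s → above g s ≡ above′ g s
      above-Φ g s = when-cong (¬? (T.below? Y Z s)) (¬? (T′.below? (Φ Y) (Φ Z) s))
        (_∘ from) (_∘ to) (λ _ → refl)

  equalCounts-bounded : ∀ k {Y Z} → ∣ Z ─ Y ∣ < k → T.CyclicFlatSet Y → T.CyclicFlatSet Z → Y ⊆ Z → EqualCounts Y Z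
  equalCounts-bounded (suc k) {Y} {Z} bound cfY cfZ Y⊆Z with Y ≟ Z
  ... | yes refl = equalCounts-self cfY
  ... | no  Y≢Z  = equalCounts-step cfY cfZ Y⊆Z Y≢Z
    (λ cfW Y⊆W W⊆Z W≢Y → equalCounts-bounded k
      (ℕ.<-≤-trans (∣─∣-shrinkˡ Y⊆W W⊆Z W≢Y) (s≤s⁻¹ bound)) cfW cfZ W⊆Z)
    (λ cfW Y⊆W W⊆Z W≢Z → equalCounts-bounded k
      (ℕ.<-≤-trans (∣─∣-shrinkʳ Y⊆W W⊆Z W≢Z) (s≤s⁻¹ bound)) cfY cfW Y⊆W)

  equalCounts : ∀ {Y Z} → T.CyclicFlatSet Y → T.CyclicFlatSet Z → Y ⊆ Z → EqualCounts Y Z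
  equalCounts = equalCounts-bounded _ (ℕ.n<1+n _)

  -- Matched flats and the comparison of weights

  record Matched (F : Subset n) (F′ : Subset n′) : Set where
    field
      flat    : IsFlat M F
      flat′   : IsFlat M′ F′
      cyclic≡ : Φ (T.cyc F) ≡ T′.cyc F′
      rank≡   : r F ≡ r′ F′

  open Matched

  matched-size : ∀ {F F′} → Matched F F′ → ∣ F ∣ ≡ ∣ F′ ∣
  matched-size {F} {F′} m = ℕ.+-cancelˡ-≡ (r (T.cyc F)) _ _ (begin
    r (T.cyc F) + ∣ F ∣       ≡⟨ T.rank-size-cyc F ⟨
    r F + ∣ T.cyc F ∣         ≡⟨ cong₂ _+_ (rank≡ m) (trans (sym (Φ-size cf)) (cong ∣_∣ (cyclic≡ m))) ⟩
    r′ F′ + ∣ T′.cyc F′ ∣     ≡⟨ T′.rank-size-cyc F′ ⟩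
    r′ (T′.cyc F′) + ∣ F′ ∣   ≡⟨ cong (_+ ∣ F′ ∣) (trans (cong r′ (sym (cyclic≡ m))) (Φ-rank cf)) ⟩
    r (T.cyc F) + ∣ F′ ∣      ∎)
    where
    open ≡-Reasoning
    cf = T.cyc-cyclicFlat (flat m)

  ∑-flats-matched : ∀ {W F F′} → Matched F F′ → T.CyclicFlatSet W → W ⊆ T.cyc F →
                    ∀ g → T.∑-flats W F g ≡ T′.∑-flats (Φ W) F′ g
  ∑-flats-matched {W} {F} {F′} m cfW W⊆ g = begin
    T.∑-flats W F g
      ≡⟨ T.Coloops.∑-flats-cyc (flat m) W g ⟩
    T.∑-flats W (T.cyc F) (λ s → intervalSum (∣ F ∣ ∸ ∣ T.cyc F ∣) s g)
      ≡⟨ flats (equalCounts cfW cf W⊆) (λ s → intervalSum (∣ F ∣ ∸ ∣ T.cyc F ∣) s g) ⟩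
    T′.∑-flats (Φ W) (Φ (T.cyc F)) (λ s → intervalSum (∣ F ∣ ∸ ∣ T.cyc F ∣) s g)
      ≡⟨ cong (λ Z → T′.∑-flats (Φ W) Z (λ s → intervalSum (∣ F ∣ ∸ ∣ T.cyc F ∣) s g)) (cyclic≡ m) ⟩
    T′.∑-flats (Φ W) (T′.cyc F′) (λ s → intervalSum (∣ F ∣ ∸ ∣ T.cyc F ∣) s g)
      ≡⟨ T′.∑-flats-cong (Φ W) (T′.cyc F′) (λ s → cong (λ d → intervalSum d s g)
           (cong₂ _∸_ (matched-size m) (trans (sym (Φ-size cf)) (cong ∣_∣ (cyclic≡ m))))) ⟩
    T′.∑-flats (Φ W) (T′.cyc F′) (λ s → intervalSum (∣ F′ ∣ ∸ ∣ T′.cyc F′ ∣) s g)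
      ≡⟨ T′.Coloops.∑-flats-cyc (flat′ m) (Φ W) g ⟨
    T′.∑-flats (Φ W) F′ g ∎
    where
    open ≡-Reasoning
    cf = T.cyc-cyclicFlat (flat m)

  -- Matching is many-to-many, so this also forces `u` to be constant on the flats that share a
  -- partner.
  Agree : (Subset n → ℕ) → (Subset n′ → ℕ) → Set
  Agree u u′ = ∀ {F F′} → Matched F F′ → u F ≡ u′ F′

  -- `Φ` matches the groups by cyclic part. Any two members of corresponding groups are matched, so
  -- the weights agree throughout and only the group sizes matter; these are `∑-flats` of the
  -- indicator of a single size.
  ∑-lowerCovers-matched : ∀ {u u′ F F′} → Agree u u′ → Matched F F′ →
    ∑ˢ (λ G → when (T.cover? G F) (u G)) ≡ ∑ˢ (λ G → when (T′.cover? G F′) (u′ G))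
  ∑-lowerCovers-matched {u} {u′} {F} {F′} agree m = begin
    ∑ˢ (λ G → when (T.cover? G F) (u G))
      ≡⟨ T.∑-lowerCovers u (flat m) ⟩
    ∑ˢ (λ W → when (T.cyclicFlatBetween? ⊥ (T.cyc F) W) (∑ˢ (λ G → when (T.lowerCoverOver? W F G) (u G))))
      ≡⟨ ∑ˢ-reindex (T.cyclicFlatBetween? ⊥ (T.cyc F)) (T′.cyclicFlatBetween? ⊥ (T′.cyc F′)) Φ Ψ
           _ (λ W → ∑ˢ (λ G → when (T′.lowerCoverOver? W F′ G) (u′ G)))
           (λ W (cfW , _ , W⊆) →
             (Φ-cyclicFlat cfW , ⊥⊆ , subst (Φ W ⊆_) (cyclic≡ m) (Φ-mono cfW cf W⊆)) ,
             ΨΦ cfW , fibre cfW W⊆)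
           (λ W (cfW , _ , W⊆) →
             (Ψ-cyclicFlat cfW , ⊥⊆ ,
              Φ-cancel (Ψ-cyclicFlat cfW) cf (subst₂ _⊆_ (sym (ΦΨ cfW)) (sym (cyclic≡ m)) W⊆)) ,
             ΦΨ cfW) ⟩
    ∑ˢ (λ W → when (T′.cyclicFlatBetween? ⊥ (T′.cyc F′) W) (∑ˢ (λ G → when (T′.lowerCoverOver? W F′ G) (u′ G))))
      ≡⟨ T′.∑-lowerCovers u′ (flat′ m) ⟨
    ∑ˢ (λ G → when (T′.cover? G F′) (u′ G)) ∎
    where
    open ≡-Reasoning
    cf = T.cyc-cyclicFlat (flat m)
    module _ {W} (cfW : T.CyclicFlatSet W) (W⊆ : W ⊆ T.cyc F) where
      isCover? : ∀ s → Dec (r W + suc s ≡ r F + ∣ W ∣)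
      isCover? s = (r W + suc s) ℕ.≟ (r F + ∣ W ∣)
      isCover?′ : ∀ s → Dec (r′ (Φ W) + suc s ≡ r′ F′ + ∣ Φ W ∣)
      isCover?′ s = (r′ (Φ W) + suc s) ℕ.≟ (r′ F′ + ∣ Φ W ∣)
      to : ∀ s → r W + suc s ≡ r F + ∣ W ∣ → r′ (Φ W) + suc s ≡ r′ F′ + ∣ Φ W ∣
      to s = subst₂ _≡_ (cong (_+ suc s) (sym (Φ-rank cfW))) (cong₂ _+_ (rank≡ m) (sym (Φ-size cfW)))
      from : ∀ s → r′ (Φ W) + suc s ≡ r′ F′ + ∣ Φ W ∣ → r W + suc s ≡ r F + ∣ W ∣
      from s = subst₂ _≡_ (cong (_+ suc s) (Φ-rank cfW)) (cong₂ _+_ (sym (rank≡ m)) (Φ-size cfW))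
      number : ∑ˢ (λ G → when (T.lowerCoverOver? W F G) 1) ≡ ∑ˢ (λ G → when (T′.lowerCoverOver? (Φ W) F′ G) 1)
      number = begin
        ∑ˢ (λ G → when (T.lowerCoverOver? W F G) 1)
          ≡⟨ ∑-cong (powerset n) (λ G → when-× (T.flatIn? W F G) (isCover? (∣ G ∣)) 1) ⟩
        T.∑-flats W F (λ s → when (isCover? s) 1)
          ≡⟨ ∑-flats-matched m cfW W⊆ (λ s → when (isCover? s) 1) ⟩
        T′.∑-flats (Φ W) F′ (λ s → when (isCover? s) 1)
          ≡⟨ T′.∑-flats-cong (Φ W) F′ (λ s → when-cong (isCover? s) (isCover?′ s) (to s) (from s) (λ _ → refl)) ⟩
        T′.∑-flats (Φ W) F′ (λ s → when (isCover?′ s) 1)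
          ≡⟨ ∑-cong (powerset n′) (λ G → when-× (T′.flatIn? (Φ W) F′ G) (isCover?′ (∣ G ∣)) 1) ⟨
        ∑ˢ (λ G → when (T′.lowerCoverOver? (Φ W) F′ G) 1) ∎
      fibre : ∑ˢ (λ G → when (T.lowerCoverOver? W F G) (u G)) ≡ ∑ˢ (λ G → when (T′.lowerCoverOver? (Φ W) F′ G) (u′ G))
      fibre = ∑-when-constant (T.lowerCoverOver? W F) (T′.lowerCoverOver? (Φ W) F′) (powerset n) (powerset n′)
        (λ { G G′ low@((flatG , _ , cycG≡W) , _) low′@((flatG′ , _ , cycG′≡ΦW) , _) → agree record
          { flat    = flatG
          ; flat′   = flatG′
          ; cyclic≡ = trans (cong Φ cycG≡W) (sym cycG′≡ΦW)
          ; rank≡   = ℕ.suc-injective (trans (T.lowerCoverOver-rank low)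
                        (trans (rank≡ m) (sym (T′.lowerCoverOver-rank low′))))
          } })
        number

  -- Tests `V` and `V′` only against agreeing weights, which is weaker than agreement of `V` and
  -- `V′` on matched flats and is what survives a step upward.
  SamePairing : (Subset n → ℕ) → (Subset n′ → ℕ) → Set
  SamePairing V V′ = ∀ {u u′} → Agree u u′ → T.pairing u V ≡ T′.pairing u′ V′

  -- The adjoint moves the step onto the weight, where it becomes a sum over lower covers and
  -- preserves agreement; `w` depends on sizes only, and matched flats have equal sizes.
  samePairing-upperSum : ∀ {V V′} w → SamePairing V V′ → SamePairing (T.upperSum w V) (T′.upperSum w V′)
  samePairing-upperSum {V} {V′} w same {u} {u′} agree = begin
    T.pairing u (T.upperSum w V)       ≡⟨ T.pairing-adjoint w u V ⟩
    T.pairing (T.lowerSum w u) V       ≡⟨ same (λ {F} {F′} m → ∑-lowerCovers-matched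
                                            (λ m₁ → cong₂ _*_ (agree m₁) (cong₂ w (matched-size m₁) (matched-size m))) m) ⟩
    T′.pairing (T′.lowerSum w u′) V′   ≡⟨ T′.pairing-adjoint w u′ V′ ⟨
    T′.pairing u′ (T′.upperSum w V′)   ∎
    where open ≡-Reasoning

  samePairing-scale : ∀ {V V′ c c′} → Agree c c′ → SamePairing V V′ →
                      SamePairing (λ F → c F * V F) (λ F → c′ F * V′ F)
  samePairing-scale {V} {V′} {c} {c′} agree-c same {u} {u′} agree = begin
    T.pairing u (λ F → c F * V F)
      ≡⟨ ∑-cong (powerset n) (λ F → cong (when (isFlat? M F)) (ℕ.*-assoc (u F) (c F) (V F))) ⟨
    T.pairing (λ F → u F * c F) V
      ≡⟨ same (λ m → cong₂ _*_ (agree m) (agree-c m)) ⟩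
    T′.pairing (λ F → u′ F * c′ F) V′
      ≡⟨ ∑-cong (powerset n′) (λ F → cong (when (isFlat? M′ F)) (ℕ.*-assoc (u′ F) (c′ F) (V′ F))) ⟩
    T′.pairing u′ (λ F → c′ F * V′ F) ∎
    where open ≡-Reasoning

  module _ (noColoops : NoColoops M) (noColoops′ : NoColoops M′) where

    private
      cf⊤  = T.⊤-cyclicFlat noColoops
      cf⊤′ = T′.⊤-cyclicFlat noColoops′

    -- Without coloops both ground sets are the greatest cyclic flats, and an order isomorphism
    -- matches greatest elements. Number of elements and rank, which the configuration does not
    -- list, are read off here.
    Φ-⊤ : Φ ⊤ ≡ ⊤
    Φ-⊤ = ⊆-antisym ⊆⊤ (subst (_⊆ Φ ⊤) (ΦΨ cf⊤′) (Φ-mono (Ψ-cyclicFlat cf⊤′) cf⊤ ⊆⊤))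

    size≡ : n ≡ n′
    size≡ = begin
      n              ≡⟨ ∣⊤∣≡n n ⟨
      ∣ ⊤ {n} ∣      ≡⟨ Φ-size cf⊤ ⟨
      ∣ Φ ⊤ ∣        ≡⟨ cong ∣_∣ Φ-⊤ ⟩
      ∣ ⊤ {n′} ∣     ≡⟨ ∣⊤∣≡n n′ ⟩
      n′             ∎
      where open ≡-Reasoning

    rk≡ : rk M ≡ rk M′
    rk≡ = trans (sym (Φ-rank cf⊤)) (cong r′ Φ-⊤)

    matched-⊤ : Matched ⊤ ⊤
    matched-⊤ = record
      { flat    = T.⊤-flat
      ; flat′   = T′.⊤-flat
      ; cyclic≡ = trans (cong Φ (T.cyc-≡ cf⊤)) (trans Φ-⊤ (sym (T′.cyc-≡ cf⊤′)))
      ; rank≡   = rk≡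
      }

    samePairing-⊤ : SamePairing (λ F → when (F ≟ ⊤) 1) (λ F → when (F ≟ ⊤) 1)
    samePairing-⊤ {u} {u′} agree = trans (pairing-⊤ M u) (trans (agree matched-⊤) (sym (pairing-⊤ M′ u′)))
      where
      pairing-⊤ : ∀ {m} (N : Matroid m) (v : Subset m → ℕ) →
                  MatroidTheory.pairing N v (λ F → when (F ≟ ⊤) 1) ≡ v ⊤
      pairing-⊤ {m} N v = trans (∑-cong (powerset m) λ F → trans
          (trans (cong (when (isFlat? N F)) (sym (when-*ʳ (F ≟ ⊤) (v F) 1)))
            (sym (when-× (isFlat? N F) (F ≟ ⊤) (v F * 1))))
          (when-cong (isFlat? N F ×-dec (F ≟ ⊤)) (F ≟ ⊤) proj₂
            (λ { refl → MatroidTheory.⊤-flat N , refl }) (λ _ → ℕ.*-identityʳ (v F))))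
        (∑ˢ-point ⊤ v)

-- Flags and linear orderings

vector≟ : (u v : Vec ℕ k) → Dec (u ≡ v)
vector≟ = Vec.≡-dec ℕ._≟_

module Enumeration {n} (M : Matroid n) where

  open MatroidTheory M
  open Matroid M using (monotone) renaming (rank to r)

  -- Counts the chains from `F` to `⊤` with successive differences `as`, as iterated upward sums, so
  -- that it can be compared one step at a time.
  flagsAbove : Vec ℕ k → Subset n → ℕ
  flagsAbove []       F = when (F ≟ ⊤) 1
  flagsAbove (a ∷ as) F = upperSum (λ f g → when ((g ∸ f) ℕ.≟ a) 1) (flagsAbove as) F

  flagNumber : Vec ℕ (suc k) → ℕ
  flagNumber (a ∷ as) = pairing (λ F → when ((r F ℕ.≟ 0) ×-dec (∣ F ∣ ℕ.≟ a)) 1) (flagsAbove as)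

  Chain : Subset n → Vec (Subset n) k → Vec ℕ k → Set
  Chain F []       []       = F ≡ ⊤
  Chain F (G ∷ Gs) (a ∷ as) = Cover F G × ∣ G ∣ ∸ ∣ F ∣ ≡ a × Chain G Gs as

  chain? : ∀ F (Gs : Vec (Subset n) k) as → Dec (Chain F Gs as)
  chain? F []       []       = F ≟ ⊤
  chain? F (G ∷ Gs) (a ∷ as) = cover? F G ×-dec ((∣ G ∣ ∸ ∣ F ∣) ℕ.≟ a) ×-dec chain? G Gs as

  ∑-chains : ∀ F (as : Vec ℕ k) →
             ∑ (vectors (powerset n) k) (λ Gs → when (chain? F Gs as) 1) ≡ flagsAbove as F
  ∑-chains F []       = ℕ.+-identityʳ _
  ∑-chains {suc k} F (a ∷ as) = trans (∑-vectors (powerset n) k _) (∑-cong (powerset n) λ G → begin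
    ∑ (vectors (powerset n) k) (λ Gs → when (chain? F (G ∷ Gs) (a ∷ as)) 1)
      ≡⟨ ∑-cong (vectors (powerset n) k) (λ Gs → trans
           (when-× (cover? F G) (((∣ G ∣ ∸ ∣ F ∣) ℕ.≟ a) ×-dec chain? G Gs as) 1)
           (cong (when (cover? F G)) (when-× ((∣ G ∣ ∸ ∣ F ∣) ℕ.≟ a) (chain? G Gs as) 1))) ⟩
    ∑ (vectors (powerset n) k) (λ Gs → when (cover? F G) (when ((∣ G ∣ ∸ ∣ F ∣) ℕ.≟ a) (when (chain? G Gs as) 1)))
      ≡⟨ trans (∑-when (cover? F G) (vectors (powerset n) k) _)
           (cong (when (cover? F G)) (∑-when ((∣ G ∣ ∸ ∣ F ∣) ℕ.≟ a) (vectors (powerset n) k) _)) ⟩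
    when (cover? F G) (when ((∣ G ∣ ∸ ∣ F ∣) ℕ.≟ a) (∑ (vectors (powerset n) k) (λ Gs → when (chain? G Gs as) 1)))
      ≡⟨ cong (λ x → when (cover? F G) (when ((∣ G ∣ ∸ ∣ F ∣) ℕ.≟ a) x))
           (trans (∑-chains G as) (sym (ℕ.*-identityˡ _))) ⟩
    when (cover? F G) (when ((∣ G ∣ ∸ ∣ F ∣) ℕ.≟ a) (1 * flagsAbove as G))
      ≡⟨ cong (when (cover? F G)) (when-*ˡ ((∣ G ∣ ∸ ∣ F ∣) ℕ.≟ a) 1 _) ⟩
    when (cover? F G) (when ((∣ G ∣ ∸ ∣ F ∣) ℕ.≟ a) 1 * flagsAbove as G) ∎)
    where open ≡-Reasoning

  -- Dropping the bottom member of a flag leaves a chain whose ranks start at s = 1, 2, ….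
  FlagFrom : ℕ → Vec (Subset n) (suc k) → Set
  FlagFrom {k} s X = (∀ j → IsFlat M (lookup X j) × r (lookup X j) ≡ s + toℕ j)
                   × (∀ (j : Fin k) → lookup X (inject₁ j) ⊂ lookup X (suc j))
                   × lookup X (fromℕ k) ≡ ⊤

  flag⇒chain : ∀ s F (Gs : Vec (Subset n) k) {a as} → FlagFrom s (F ∷ Gs) → blockSizes (F ∷ Gs) ≡ a ∷ as →
               (IsFlat M F × r F ≡ s × ∣ F ∣ ≡ a) × Chain F Gs as
  flag⇒chain s F [] {as = []} (flats , _ , top) refl =
    (proj₁ (flats zero) , trans (proj₂ (flats zero)) (ℕ.+-identityʳ s) , refl) , top
  flag⇒chain s F (G ∷ Gs) (flats , strict , top) refl
    with (flatG , rG , _) , chain ← flag⇒chain (suc s) G Gs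
           ((λ j → proj₁ (flats (suc j)) , trans (proj₂ (flats (suc j))) (ℕ.+-suc s (toℕ j))) , strict ∘ suc , top) refl
    = (flatF , rF , refl) ,
      (flatF , flatG , proj₁ (strict zero) , trans (cong suc rF) (sym rG)) , sym (∣─∣-∸ (proj₁ (strict zero))) , chain
    where
    flatF = proj₁ (flats zero)
    rF    = trans (proj₂ (flats zero)) (ℕ.+-identityʳ s)

  cover⇒⊂ : ∀ {F G} → Cover F G → F ⊂ G
  cover⇒⊂ {F} (_ , _ , F⊆G , rank) = ⊆∧≢⇒⊂ F⊆G λ { refl → ℕ.1+n≢n rank }

  chain⇒flag : ∀ s F (Gs : Vec (Subset n) k) {a as} → (IsFlat M F × r F ≡ s × ∣ F ∣ ≡ a) × Chain F Gs as →
               FlagFrom s (F ∷ Gs) × blockSizes (F ∷ Gs) ≡ a ∷ as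
  chain⇒flag s F [] {as = []} ((flat , rF , refl) , top) =
    ((λ { zero → flat , trans rF (sym (ℕ.+-identityʳ s)) }) , (λ ()) , top) , refl
  chain⇒flag s F (G ∷ Gs) {as = _ ∷ _} ((flat , rF , refl) , cover@(_ , flatG , F⊆G , rank) , refl , chain)
    with (flats , strict , top) , sizes ← chain⇒flag (suc s) G Gs ((flatG , trans (sym rank) (cong suc rF) , refl) , chain)
    = ((λ { zero → flat , trans rF (sym (ℕ.+-identityʳ s))
          ; (suc j) → proj₁ (flats j) , trans (proj₂ (flats j)) (sym (ℕ.+-suc s (toℕ j))) })
      , (λ { zero → cover⇒⊂ cover ; (suc j) → strict j }) , top) ,
      cong (∣ F ∣ ∷_) (cong₂ _∷_ (∣─∣-∸ F⊆G) (cong Vec.tail sizes))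

  ν-flagNumber : (a : Composition n (rk M)) → ν M a ≡ flagNumber (parts a)
  ν-flagNumber a = trans (length-filter-∑ (flagWithComposition? M a) (vectors (subsets n) (suc (rk M))))
    (trans (cong (λ Ss → ∑ (vectors Ss (suc (rk M))) (λ X → when (flagWithComposition? M a X) 1)) (sym (powerset≡subsets n))) (count (parts a)))
    where
    open ≡-Reasoning
    -- The composition is generalised to a bare vector, which can be split into head and tail.
    count : ∀ v → ∑ (vectors (powerset n) (suc (rk M))) (λ X → when (isFlag? M X ×-dec vector≟ (blockSizes X) v) 1)
                  ≡ flagNumber v
    count (a ∷ as) = trans (∑-vectors (powerset n) (rk M) _) (∑-cong (powerset n) λ F →
      let bottom? = (r F ℕ.≟ 0) ×-dec (∣ F ∣ ℕ.≟ a) in begin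
      ∑ (vectors (powerset n) (rk M)) (λ Gs → when (isFlag? M (F ∷ Gs) ×-dec vector≟ (blockSizes (F ∷ Gs)) (a ∷ as)) 1)
        ≡⟨ ∑-cong (vectors (powerset n) (rk M)) (λ Gs → trans
             (when-cong (isFlag? M (F ∷ Gs) ×-dec vector≟ (blockSizes (F ∷ Gs)) (a ∷ as))
               ((isFlat? M F ×-dec bottom?) ×-dec chain? F Gs as)
               (λ (flag , sizes) → flag⇒chain 0 F Gs flag sizes) (chain⇒flag 0 F Gs) (λ _ → refl))
             (when-× (isFlat? M F ×-dec bottom?) (chain? F Gs as) 1)) ⟩
      ∑ (vectors (powerset n) (rk M)) (λ Gs → when (isFlat? M F ×-dec bottom?) (when (chain? F Gs as) 1))
        ≡⟨ ∑-when (isFlat? M F ×-dec bottom?) (vectors (powerset n) (rk M)) _ ⟩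
      when (isFlat? M F ×-dec bottom?) (∑ (vectors (powerset n) (rk M)) (λ Gs → when (chain? F Gs as) 1))
        ≡⟨ cong (when (isFlat? M F ×-dec bottom?)) (trans (∑-chains F as) (sym (ℕ.*-identityˡ _))) ⟩
      when (isFlat? M F ×-dec bottom?) (1 * flagsAbove as F)
        ≡⟨ when-× (isFlat? M F) bottom? _ ⟩
      when (isFlat? M F) (when bottom? (1 * flagsAbove as F))
        ≡⟨ cong (when (isFlat? M F)) (when-*ˡ bottom? 1 _) ⟩
      when (isFlat? M F) (when bottom? 1 * flagsAbove as F) ∎)

  -- The number of ways to continue an ordering of which m elements, with closure F, have been
  -- read, so that the remaining rank increments are the given ones.
  continuations : Vec ℕ k → ℕ → Subset n → ℕ
  continuations []                   m F = when (F ≟ ⊤) 1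
  continuations (zero ∷ ts)          m F = (∣ F ∣ ∸ m) * continuations ts (suc m) F
  continuations (suc zero ∷ ts)      m F = upperSum (λ f g → g ∸ f) (continuations ts (suc m)) F
  continuations (suc (suc _) ∷ ts)   m F = 0 * continuations ts (suc m) F

  -- Distinctness is checked against the set already read, one element at a time, which lets the
  -- orderings be counted by recursion. `X ≡ X` serves as the true proposition.
  Reading : Subset n → Vec (Fin n) k → Vec ℕ k → Set
  Reading X []       []       = X ≡ X
  Reading X (e ∷ es) (t ∷ ts) = (e ∉ X × r (X ∪ ⁅ e ⁆) ∸ r X ≡ t) × Reading (X ∪ ⁅ e ⁆) es ts

  next? : ∀ X e t → Dec (e ∉ X × r (X ∪ ⁅ e ⁆) ∸ r X ≡ t)
  next? X e t = ¬? (e ∈? X) ×-dec ((r (X ∪ ⁅ e ⁆) ∸ r X) ℕ.≟ t)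

  reading? : ∀ X (es : Vec (Fin n) k) ts → Dec (Reading X es ts)
  reading? X []       []       = yes refl
  reading? X (e ∷ es) (t ∷ ts) = next? X e t ×-dec reading? (X ∪ ⁅ e ⁆) es ts

  cl-insert : ∀ {X e} → e ∈ cl X → cl (X ∪ ⁅ e ⁆) ≡ cl X
  cl-insert {X} {e} e∈ = sym (cl-unique (cl-flat X) (insert-lub (⊆-cl X) e∈)
    (ℕ.≤-trans (ℕ.≤-reflexive (rank-cl X)) (monotone (⊆-insert X e))))

  next-zero⇒∈ : ∀ {X e} → e ∉ X × r (X ∪ ⁅ e ⁆) ∸ r X ≡ 0 → e ∈ cl X ─ X
  next-zero⇒∈ {X} (e∉X , inc≡0) = x∈p∧x∉q⇒x∈p─q (∈-sift⁺ (spanned? X) (ℕ.m∸n≡0⇒m≤n inc≡0)) e∉X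

  ∈⇒next-zero : ∀ {X e} → e ∈ cl X ─ X → e ∉ X × r (X ∪ ⁅ e ⁆) ∸ r X ≡ 0
  ∈⇒next-zero {X} e∈ = let (e∈cl , e∉X) = ∈-─⁻ (cl X) X e∈ in e∉X , ℕ.m≤n⇒m∸n≡0 (∈-cl⁻ e∈cl)

  next-one⇒cover : ∀ {X e} → e ∉ X × r (X ∪ ⁅ e ⁆) ∸ r X ≡ 1 →
                   Cover (cl X) (cl (X ∪ ⁅ e ⁆)) × e ∈ cl (X ∪ ⁅ e ⁆) ─ cl X
  next-one⇒cover {X} {e} (_ , inc≡1) =
    (cl-flat X , cl-flat (X ∪ ⁅ e ⁆) ,
     cl-least (cl-flat _) (⊆-trans (⊆-insert X e) (⊆-cl (X ∪ ⁅ e ⁆))) ,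
     trans (cong suc (rank-cl X)) (trans step (sym (rank-cl (X ∪ ⁅ e ⁆))))) ,
    x∈p∧x∉q⇒x∈p─q (⊆-cl (X ∪ ⁅ e ⁆) (∈-insert X e))
      (λ e∈cl → ℕ.<⇒≱ (ℕ.≤-reflexive step) (∈-cl⁻ e∈cl))
    where
    step : suc (r X) ≡ r (X ∪ ⁅ e ⁆)
    step = trans (cong (_+ r X) (sym inc≡1)) (ℕ.m∸n+n≡m (monotone (⊆-insert X e)))

  cover⇒next-one : ∀ {X e G} → Cover (cl X) G → e ∈ G ─ cl X →
                   G ≡ cl (X ∪ ⁅ e ⁆) × e ∉ X × r (X ∪ ⁅ e ⁆) ∸ r X ≡ 1
  cover⇒next-one {X} {e} {G} (_ , flatG , clX⊆G , rank) e∈ =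
    let (e∈G , e∉cl) = ∈-─⁻ G (cl X) e∈
        step = ∉-cl⁻ e∉cl
    in cl-unique flatG (insert-lub (⊆-trans (⊆-cl X) clX⊆G) e∈G)
         (ℕ.≤-trans (ℕ.≤-reflexive (trans (sym rank) (cong suc (rank-cl X)))) step) ,
       e∉cl ∘ ⊆-cl X ,
       trans (cong (_∸ r X) (ℕ.≤-antisym (rank-step M X e) step)) (ℕ.m+n∸n≡m 1 (r X))

  -- An increment 0 reads an unread element of `cl X` and keeps the closure. An increment 1 reads an
  -- element of G ─ cl X for a cover G of `cl X`, and every such element leads to the same closure
  -- G. Larger increments do not occur.
  ∑-next : ∀ X t (ts : Vec ℕ k) →
           ∑ᶠ (λ e → when (next? X e t) (continuations ts (suc ∣ X ∣) (cl (X ∪ ⁅ e ⁆))))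
             ≡ continuations (t ∷ ts) ∣ X ∣ (cl X)
  ∑-next X zero ts = begin
    ∑ᶠ (λ e → when (next? X e 0) (K (cl (X ∪ ⁅ e ⁆))))
      ≡⟨ ∑-cong (elements n) (λ e → when-cong (next? X e 0) (e ∈? (cl X ─ X)) next-zero⇒∈ ∈⇒next-zero
           (λ next → cong K (cl-insert (p─q⊆p (cl X) X (next-zero⇒∈ next))))) ⟩
    ∑ᶠ (λ e → when (e ∈? (cl X ─ X)) (K (cl X)))
      ≡⟨ ∑ᶠ-∈ (cl X ─ X) (K (cl X)) ⟩
    ∣ cl X ─ X ∣ * K (cl X)
      ≡⟨ cong (_* K (cl X)) (∣─∣-∸ (⊆-cl X)) ⟩
    (∣ cl X ∣ ∸ ∣ X ∣) * K (cl X) ∎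
    where
    open ≡-Reasoning
    K = continuations ts (suc ∣ X ∣)
  ∑-next X (suc zero) ts = begin
    ∑ᶠ (λ e → when (next? X e 1) (K (cl (X ∪ ⁅ e ⁆))))
      ≡⟨ ∑ˢ-fibres (λ e → cl (X ∪ ⁅ e ⁆)) (elements n) _ ⟩
    ∑ˢ (λ G → ∑ᶠ (λ e → when (G ≟ cl (X ∪ ⁅ e ⁆)) (when (next? X e 1) (K (cl (X ∪ ⁅ e ⁆))))))
      ≡⟨ ∑-cong (powerset n) (λ G → begin
           ∑ᶠ (λ e → when (G ≟ cl (X ∪ ⁅ e ⁆)) (when (next? X e 1) (K (cl (X ∪ ⁅ e ⁆)))))
             ≡⟨ ∑-cong (elements n) (step G) ⟩
           ∑ᶠ (λ e → when (cover? (cl X) G) (when (e ∈? (G ─ cl X)) (K G)))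
             ≡⟨ ∑-when (cover? (cl X) G) (elements n) _ ⟩
           when (cover? (cl X) G) (∑ᶠ (λ e → when (e ∈? (G ─ cl X)) (K G)))
             ≡⟨ when-congʳ (cover? (cl X) G) (λ (_ , _ , clX⊆G , _) →
                  trans (∑ᶠ-∈ (G ─ cl X) (K G)) (cong (_* K G) (∣─∣-∸ clX⊆G))) ⟩
           when (cover? (cl X) G) ((∣ G ∣ ∸ ∣ cl X ∣) * K G) ∎) ⟩
    upperSum (λ f g → g ∸ f) K (cl X) ∎
    where
    open ≡-Reasoning
    K = continuations ts (suc ∣ X ∣)
    step : ∀ G e → when (G ≟ cl (X ∪ ⁅ e ⁆)) (when (next? X e 1) (K (cl (X ∪ ⁅ e ⁆))))
                   ≡ when (cover? (cl X) G) (when (e ∈? (G ─ cl X)) (K G))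
    step G e = begin
      when (G ≟ cl (X ∪ ⁅ e ⁆)) (when (next? X e 1) (K (cl (X ∪ ⁅ e ⁆))))
        ≡⟨ when-× (G ≟ cl (X ∪ ⁅ e ⁆)) (next? X e 1) _ ⟨
      when ((G ≟ cl (X ∪ ⁅ e ⁆)) ×-dec next? X e 1) (K (cl (X ∪ ⁅ e ⁆)))
        ≡⟨ when-cong ((G ≟ cl (X ∪ ⁅ e ⁆)) ×-dec next? X e 1) (cover? (cl X) G ×-dec (e ∈? (G ─ cl X)))
             (λ { (refl , next) → next-one⇒cover next })
             (λ (cov , e∈) → cover⇒next-one cov e∈) (λ (eq , _) → cong K (sym eq)) ⟩
      when (cover? (cl X) G ×-dec (e ∈? (G ─ cl X))) (K G)
        ≡⟨ when-× (cover? (cl X) G) (e ∈? (G ─ cl X)) _ ⟩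
      when (cover? (cl X) G) (when (e ∈? (G ─ cl X)) (K G)) ∎
  ∑-next X (suc (suc t)) ts = ∑-zero (elements n) λ e → when-false (next? X e (suc (suc t)))
    λ (_ , inc≡) → ℕ.<⇒≱ (s≤s (s≤s z≤n)) (ℕ.≤-trans (ℕ.≤-reflexive (sym inc≡)) (increment≤1 M X e))

  ∑-readings : ∀ X (ts : Vec ℕ k) → ∣ X ∣ + k ≡ n →
               ∑ (vectors (elements n) k) (λ es → when (reading? X es ts) 1) ≡ continuations ts ∣ X ∣ (cl X)
  -- All `n` elements have been read, so the closure is the ground set and both sides are 1.
  ∑-readings X [] full = sym (when-true (cl X ≟ ⊤)
    (⊆-antisym ⊆⊤ (subst (_⊆ cl X) (∣p∣≡n⇒p≡⊤ (trans (sym (ℕ.+-identityʳ _)) full)) (⊆-cl X))))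
  ∑-readings {suc k} X (t ∷ ts) full = begin
    ∑ (vectors (elements n) (suc k)) (λ es → when (reading? X es (t ∷ ts)) 1)
      ≡⟨ ∑-vectors (elements n) k _ ⟩
    ∑ᶠ (λ e → ∑ (vectors (elements n) k) (λ es → when (reading? X (e ∷ es) (t ∷ ts)) 1))
      ≡⟨ ∑-cong (elements n) (λ e → begin
           ∑ (vectors (elements n) k) (λ es → when (reading? X (e ∷ es) (t ∷ ts)) 1)
             ≡⟨ ∑-cong (vectors (elements n) k) (λ es → when-× (next? X e t) (reading? (X ∪ ⁅ e ⁆) es ts) 1) ⟩
           ∑ (vectors (elements n) k) (λ es → when (next? X e t) (when (reading? (X ∪ ⁅ e ⁆) es ts) 1))
             ≡⟨ ∑-when (next? X e t) (vectors (elements n) k) _ ⟩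
           when (next? X e t) (∑ (vectors (elements n) k) (λ es → when (reading? (X ∪ ⁅ e ⁆) es ts) 1))
             ≡⟨ when-congʳ (next? X e t) (λ (e∉X , _) → trans
                  (∑-readings (X ∪ ⁅ e ⁆) ts (trans (cong (_+ k) (∣insert∣ X e∉X)) (trans (sym (ℕ.+-suc (∣ X ∣) k)) full)))
                  (cong (λ m → continuations ts m (cl (X ∪ ⁅ e ⁆))) (∣insert∣ X e∉X))) ⟩
           when (next? X e t) (continuations ts (suc ∣ X ∣) (cl (X ∪ ⁅ e ⁆))) ∎) ⟩
    ∑ᶠ (λ e → when (next? X e t) (continuations ts (suc ∣ X ∣) (cl (X ∪ ⁅ e ⁆))))
      ≡⟨ ∑-next X t ts ⟩
    continuations (t ∷ ts) ∣ X ∣ (cl X) ∎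
    where open ≡-Reasoning

  ordering⇒reading : ∀ X (es : Vec (Fin n) k) → All (_∉ X) es → Unique es → Reading X es (increments M X es)
  ordering⇒reading X []       []            []          = refl
  ordering⇒reading X (e ∷ es) (e∉X ∷ es∉X) (e∉es ∷ un) = (e∉X , refl) ,
    ordering⇒reading (X ∪ ⁅ e ⁆) es
      (VecAll.map (λ (x∉X , e≢x) x∈ → Sum.[ x∉X , (λ x≡e → e≢x (sym x≡e)) ] (∈-insert⁻ X e x∈)) (VecAll.zip (es∉X , e∉es))) un

  reading⇒ordering : ∀ X (es : Vec (Fin n) k) {ts} → Reading X es ts →
                     All (_∉ X) es × Unique es × increments M X es ≡ ts
  reading⇒ordering X []       {[]}    _ = [] , [] , refl
  reading⇒ordering X (e ∷ es) {_ ∷ _} ((e∉X , inc) , reading)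
    with out , un , incs ← reading⇒ordering (X ∪ ⁅ e ⁆) es reading
    = (e∉X ∷ VecAll.map (_∘ ⊆-insert X e) out) ,
      (VecAll.map (λ { x∉ refl → x∉ (∈-insert X e) }) out ∷ un) , cong₂ _∷_ inc incs

  -- The only flat of rank 0 is `cl ⊥`, so this is the single value `continuations ts 0 (cl ⊥)`; it
  -- is written as a pairing because pairings are what the two matroids share.
  orderingNumber : Vec ℕ k → ℕ
  orderingNumber ts = pairing (λ F → when (r F ℕ.≟ 0) 1) (continuations ts 0)

  unique? : (es : Vec (Fin n) k) → Dec (Unique es)
  unique? = AllPairs.allPairs? (λ x y → ¬? (x Fin.≟ y))

  ∑-orderings : ∀ ts → ∑ (vectors (allFin n) n) (λ es → when (unique? es ×-dec vector≟ (increments M ⊥ es) ts) 1)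
                       ≡ orderingNumber ts
  ∑-orderings ts = begin
    ∑ (vectors (allFin n) n) (λ es → when (unique? es ×-dec vector≟ (increments M ⊥ es) ts) 1)
      ≡⟨ cong (λ xs → ∑ (vectors xs n) (λ es → when (unique? es ×-dec vector≟ (increments M ⊥ es) ts) 1)) (elements≡allFin n) ⟨
    ∑ (vectors (elements n) n) (λ es → when (unique? es ×-dec vector≟ (increments M ⊥ es) ts) 1)
      ≡⟨ ∑-cong (vectors (elements n) n) (λ es → when-cong (unique? es ×-dec vector≟ (increments M ⊥ es) ts) (reading? ⊥ es ts)
           (λ { (un , refl) → ordering⇒reading ⊥ es (VecAll.universal (λ _ → ∉⊥) es) un })
           (λ reading → proj₂ (reading⇒ordering ⊥ es reading)) (λ _ → refl)) ⟩
    ∑ (vectors (elements n) n) (λ es → when (reading? ⊥ es ts) 1)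
      ≡⟨ ∑-readings ⊥ ts (cong (_+ n) (∣⊥∣≡0 n)) ⟩
    continuations ts (∣ ⊥ {n} ∣) (cl ⊥)
      ≡⟨ cong (λ m → continuations ts m (cl ⊥)) (∣⊥∣≡0 n) ⟩
    continuations ts 0 (cl ⊥)
      ≡⟨ ∑ˢ-point (cl ⊥) (continuations ts 0) ⟨
    ∑ˢ (λ F → when (F ≟ cl ⊥) (continuations ts 0 F))
      ≡⟨ ∑-cong (powerset n) (λ F → when-cong (F ≟ cl ⊥) (isFlat? M F ×-dec (r F ℕ.≟ 0))
           (λ { refl → cl-flat ⊥ , trans (rank-cl ⊥) (rank-⊥ M) })
           (λ (flat , rF≡0) → cl-unique flat ⊥⊆ (ℕ.≤-trans (ℕ.≤-reflexive rF≡0) z≤n)) (λ _ → refl)) ⟩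
    ∑ˢ (λ F → when (isFlat? M F ×-dec (r F ℕ.≟ 0)) (continuations ts 0 F))
      ≡⟨ ∑-cong (powerset n) (λ F → begin
           when (isFlat? M F ×-dec (r F ℕ.≟ 0)) (continuations ts 0 F)
             ≡⟨ when-× (isFlat? M F) (r F ℕ.≟ 0) _ ⟩
           when (isFlat? M F) (when (r F ℕ.≟ 0) (continuations ts 0 F))
             ≡⟨ cong (λ x → when (isFlat? M F) (when (r F ℕ.≟ 0) x)) (ℕ.*-identityˡ _) ⟨
           when (isFlat? M F) (when (r F ℕ.≟ 0) (1 * continuations ts 0 F))
             ≡⟨ cong (when (isFlat? M F)) (when-*ˡ (r F ℕ.≟ 0) 1 _) ⟩
           when (isFlat? M F) (when (r F ℕ.≟ 0) 1 * continuations ts 0 F) ∎) ⟩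
    orderingNumber ts ∎
    where open ≡-Reasoning

  ∑-mapMaybe : (f : LinearOrdering n → ℕ) (vs : List (Vec (Fin n) n)) →
               ∑ (mapMaybe asOrdering vs) f ≡ ∑ vs (λ v → maybe′ f 0 (asOrdering v))
  ∑-mapMaybe f []       = refl
  ∑-mapMaybe f (v ∷ vs) with asOrdering v
  ... | just π  = cong (f π +_) (∑-mapMaybe f vs)
  ... | nothing = ∑-mapMaybe f vs

  ∑-linearOrderings : ∀ ts → ∑ (linearOrderings n) (λ π → when (vector≟ (bits (rankSequence M π)) ts) 1) ≡ orderingNumber ts
  ∑-linearOrderings ts = trans (∑-mapMaybe _ (vectors (allFin n) n))
    (trans (∑-cong (vectors (allFin n) n) step) (∑-orderings ts))
    where
    step : ∀ v → maybe′ (λ π → when (vector≟ (bits (rankSequence M π)) ts) 1) 0 (asOrdering v)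
                 ≡ when (unique? v ×-dec vector≟ (increments M ⊥ v) ts) 1
    step v with AllPairs.allPairs? (λ x y → ¬? (x Fin.≟ y)) v
    ... | yes _ = refl
    ... | no _  = refl

-- Coefficients in the field, and transport along equal size and rank

module _ {c ℓ₁ ℓ₂} (K : HeytingField c ℓ₁ ℓ₂) where

  open CommutativeRing (fieldRing K) using (Carrier; _≈_; 0#; 1#; +-congˡ; +-identityˡ) renaming (_+_ to _+ᴷ_; refl to ≈-refl; sym to ≈-sym; trans to ≈-trans)

  natural : ℕ → Carrier
  natural zero    = 0#
  natural (suc m) = 1# +ᴷ natural m

  𝒢-coefficient : ∀ {n} (M : Matroid n) t → 𝒢-invariant M K t ≈ natural (Enumeration.orderingNumber M (bits t))
  𝒢-coefficient {n} M t = subst (λ m → 𝒢-invariant M K t ≈ natural m)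
    (Enumeration.∑-linearOrderings M (bits t)) (go (linearOrderings n))
    where
    open Module (𝒢-space K n (rk M)) using (_+ᴹ_; 0ᴹ)
    go : ∀ πs → List.foldr _+ᴹ_ 0ᴹ (List.map (λ π → symbol K (rankSequence M π)) πs) t
                ≈ natural (∑ πs (λ π → when (vector≟ (bits (rankSequence M π)) (bits t)) 1))
    go []       = ≈-refl
    go (π ∷ πs) with does (vector≟ (bits (rankSequence M π)) (bits t))
    ... | true  = +-congˡ (go πs)
    ... | false = ≈-trans (+-identityˡ _) (go πs)

  -- `rk M` and `rk M′` are not variables, so their equation can be matched with `refl` only after
  -- this generalisation. `h` and `h′` accept vectors of every length and need no transport.
  subst₂-𝒢-space : ∀ {n n′ r r′} (p : n ≡ n′) (q : r ≡ r′)
                   (f : Module.Carrierᴹ (𝒢-space K n r)) (g : Module.Carrierᴹ (𝒢-space K n′ r′))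
                   (h h′ : ∀ {k} → Vec ℕ k → ℕ) → (∀ {k} (v : Vec ℕ k) → h v ≡ h′ v) →
                   (∀ t → f t ≈ natural (h (bits t))) → (∀ t → g t ≈ natural (h′ (bits t))) →
                   Module._≈ᴹ_ (𝒢-space K n′ r′) (subst₂ (λ m r → Module.Carrierᴹ (𝒢-space K m r)) p q f) g
  subst₂-𝒢-space refl refl f g h h′ h≡h′ f≈h g≈h′ t =
    ≈-trans (f≈h t) (subst (λ m → natural m ≈ g t) (sym (h≡h′ (bits t))) (≈-sym (g≈h′ t)))

subst₂-CatenaryData : ∀ {n n′ r r′} (p : n ≡ n′) (q : r ≡ r′) (f : CatenaryData n r) (g : CatenaryData n′ r′)
                      (h h′ : ∀ {k} → Vec ℕ (suc k) → ℕ) → (∀ {k} (v : Vec ℕ (suc k)) → h v ≡ h′ v) →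
                      (∀ a → f a ≡ h (parts a)) → (∀ a → g a ≡ h′ (parts a)) →
                      ∀ a → subst₂ CatenaryData p q f a ≡ g a
subst₂-CatenaryData refl refl f g h h′ h≡h′ f≡h g≡h′ a = trans (f≡h a) (trans (h≡h′ (parts a)) (sym (g≡h′ a)))

-- Equal numbers of flags and of orderings

module _ {n n′} (M : Matroid n) (M′ : Matroid n′) (noColoops : NoColoops M) (noColoops′ : NoColoops M′)
         (iso : configuration M ≅ configuration M′) where

  open Comparison M M′ iso
  open Matched

  private
    module E  = Enumeration M
    module E′ = Enumeration M′

  samePairing-flagsAbove : (as : Vec ℕ k) → SamePairing (E.flagsAbove as) (E′.flagsAbove as)
  samePairing-flagsAbove []       = samePairing-⊤ noColoops noColoops′
  samePairing-flagsAbove (a ∷ as) = samePairing-upperSum (λ f g → when ((g ∸ f) ℕ.≟ a) 1) (samePairing-flagsAbove as)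

  flagNumber≡ : (as : Vec ℕ (suc k)) → E.flagNumber as ≡ E′.flagNumber as
  flagNumber≡ (a ∷ as) = samePairing-flagsAbove as λ m →
    cong₂ (λ ρ s → when ((ρ ℕ.≟ 0) ×-dec (s ℕ.≟ a)) 1) (rank≡ m) (matched-size m)

  samePairing-continuations : (ts : Vec ℕ k) (m : ℕ) → SamePairing (E.continuations ts m) (E′.continuations ts m)
  samePairing-continuations []                 m = samePairing-⊤ noColoops noColoops′
  samePairing-continuations (zero ∷ ts)        m =
    samePairing-scale (λ matched → cong (_∸ m) (matched-size matched)) (samePairing-continuations ts (suc m))
  samePairing-continuations (suc zero ∷ ts)    m = samePairing-upperSum (λ f g → g ∸ f) (samePairing-continuations ts (suc m))
  -- The explicit factor 0 in `continuations` turns the case of an impossible increment into a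
  -- scaling.
  samePairing-continuations (suc (suc _) ∷ ts) m = samePairing-scale {c = λ _ → 0} {λ _ → 0} (λ _ → refl) (samePairing-continuations ts (suc m))

  orderingNumber≡ : (ts : Vec ℕ k) → E.orderingNumber ts ≡ E′.orderingNumber ts
  orderingNumber≡ ts = samePairing-continuations ts 0 λ m → cong (λ ρ → when (ρ ℕ.≟ 0) 1) (rank≡ m)

theorem7p3 : ∀ {c ℓ₁ ℓ₂} {n n′ : ℕ} (M : Matroid n) (M′ : Matroid n′) →
    NoColoops M → NoColoops M′ →
    configuration M ≅ configuration M′ →
    SameCatenaryData M M′
    × (∀ (K : HeytingField c ℓ₁ ℓ₂) → CharacteristicZero K → Same𝒢 K M M′)
theorem7p3 M M′ noColoops noColoops′ iso =
  (n≡n′ , rk≡ , subst₂-CatenaryData n≡n′ rk≡ (ν M) (ν M′) E.flagNumber E′.flagNumber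
    (flagNumber≡ M M′ noColoops noColoops′ iso) E.ν-flagNumber E′.ν-flagNumber) ,
  λ K _ → n≡n′ , rk≡ , subst₂-𝒢-space K n≡n′ rk≡ (𝒢-invariant M K) (𝒢-invariant M′ K) E.orderingNumber E′.orderingNumber
    (orderingNumber≡ M M′ noColoops noColoops′ iso) (𝒢-coefficient K M) (𝒢-coefficient K M′)
  where
  module E  = Enumeration M
  module E′ = Enumeration M′
  n≡n′ = Comparison.size≡ M M′ iso noColoops noColoops′
  rk≡ = Comparison.rk≡ M M′ iso noColoops noColoops′
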